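{- Let $a\ge b\ge 2$ be integers, and let $r_a,r_b\in\{0,1,2\}$ be the remainders of $a$ and $b$ modulo $3$. If the spider $S(a,b,2)$ is $e$-positive, then either $(r_a,r_b)=(0,1)$ or $r_b=0$. -}

module Defs where

open import Data.Bool.Base using (if_then_else_)
open import Data.Empty using (⊥)
open import Data.Fin.Base using (Fin; zero; suc; toℕ; splitAt)
import Data.Fin.Properties as Fin
open import Data.Integer.Base using (ℤ; +_; 0ℤ; 1ℤ)
import Data.Integer.Base as ℤ
open import Data.List.Base using (List; []; _∷_; [_]; map; concatMap; filter; foldr; length; upTo; allFin)
open import Data.List.Relation.Unary.All using (All)
open import Data.List.Relation.Unary.Linked using (Linked)
open import Data.List.Relation.Unary.Unique.Propositional using (Unique)
open import Data.Nat.Base using (ℕ; zero; suc; _+_; _∸_; _≤_; _≥_)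
import Data.Nat.Properties as ℕ
open import Data.Product.Base using (_×_; ∃)
open import Data.Sum.Base using (_⊎_; inj₁; inj₂; [_,_]; swap)
open import Data.Sum.Relation.Binary.Pointwise using (Pointwise; ⊎-symmetric; ⊎-decidable)
open import Data.Vec.Base using (Vec; []; _∷_; lookup; tabulate; count; zipWith; sum)
open import Data.Vec.Properties using (≡-dec)
import Data.Vec.Relation.Unary.All as Vec
open import Level using (0ℓ)
open import Relation.Binary.Core using (Rel)
open import Relation.Binary.Definitions using (Symmetric; Decidable)
open import Relation.Binary.PropositionalEquality using (_≡_; _≢_)
open import Relation.Nullary.Decidable using (Dec; does; no; _×-dec_; _⊎-dec_; _→-dec_; ¬?)
open import Relation.Nullary.Negation using (¬_)
open import Relation.Unary using (Pred)
import Relation.Unary as Unary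

record Graph : Set₁ where
  infix 4 _~_ _~?_
  field
    order    : ℕ
    _~_      : Rel (Fin order) 0ℓ
    ~-sym    : Symmetric _~_
    ~-irrefl : ∀ v → ¬ (v ~ v)
    _~?_     : Decidable _~_

open Graph using (order)

path : ℕ → Graph
path n = record
  { order    = n
  ; _~_      = λ i j → suc (toℕ i) ≡ toℕ j ⊎ suc (toℕ j) ≡ toℕ i
  ; ~-sym    = swap
  ; ~-irrefl = λ _ → [ ℕ.1+n≢n , ℕ.1+n≢n ]
  ; _~?_     = λ i j → (suc (toℕ i) ℕ.≟ toℕ j) ⊎-dec (suc (toℕ j) ℕ.≟ toℕ i)
  }

infixr 5 _⊎ᴳ_
_⊎ᴳ_ : Graph → Graph → Graph
G ⊎ᴳ H = record
  { order    = G.order + H.order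
  ; _~_      = λ u v → Adj (splitAt G.order u) (splitAt G.order v)
  ; ~-sym    = ⊎-symmetric G.~-sym H.~-sym
  ; ~-irrefl = λ v → irrefl (splitAt G.order v)
  ; _~?_     = λ u v → ⊎-decidable G._~?_ H._~?_ (splitAt G.order u) (splitAt G.order v)
  }
  where
  module G = Graph G
  module H = Graph H

  Adj : Rel (Fin G.order ⊎ Fin H.order) 0ℓ
  Adj = Pointwise G._~_ H._~_

  irrefl : ∀ x → ¬ Adj x x
  irrefl (inj₁ u) (Pointwise.inj₁ p) = G.~-irrefl u p
  irrefl (inj₂ v) (Pointwise.inj₂ p) = H.~-irrefl v p

-- G with one new vertex (numbered zero) joined to exactly the vertices in P.
attach : (G : Graph) {P : Pred (Fin (order G)) 0ℓ} → Unary.Decidable P → Graph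
attach G {P} P? = record
  { order    = suc G.order
  ; _~_      = Adj
  ; ~-sym    = λ {u} {v} → Adj-sym u v
  ; ~-irrefl = Adj-irrefl
  ; _~?_     = Adj?
  }
  where
  module G = Graph G

  Adj : Rel (Fin (suc G.order)) 0ℓ
  Adj zero    zero    = ⊥
  Adj zero    (suc v) = P v
  Adj (suc u) zero    = P u
  Adj (suc u) (suc v) = u G.~ v

  Adj-sym : ∀ u v → Adj u v → Adj v u
  Adj-sym zero    (suc v) p = p
  Adj-sym (suc u) zero    p = p
  Adj-sym (suc u) (suc v) p = G.~-sym p

  Adj-irrefl : ∀ v → ¬ Adj v v
  Adj-irrefl (suc v) p = G.~-irrefl v p

  Adj? : Decidable Adj
  Adj? zero    zero    = no λ ()
  Adj? zero    (suc v) = P? v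
  Adj? (suc u) zero    = P? u
  Adj? (suc u) (suc v) = u G.~? v

legs : List ℕ → Graph
legs []       = path 0
legs (l ∷ ls) = path l ⊎ᴳ legs ls

-- The first vertex of each leg, i.e. the neighbours of the centre.
Foot : ∀ ls → Pred (Fin (order (legs ls))) 0ℓ
Foot (l ∷ ls) v = [ (λ i → toℕ i ≡ 0) , Foot ls ] (splitAt l v)

foot? : ∀ ls → Unary.Decidable (Foot ls)
foot? (l ∷ ls) v with splitAt l v
... | inj₁ i = toℕ i ℕ.≟ 0
... | inj₂ w = foot? ls w

-- spider (l₁ ∷ … ∷ lₖ ∷ []) is S(l₁,…,lₖ): paths on l₁, …, lₖ vertices, with
-- one end of each joined to a common central vertex.
spider : List ℕ → Graph
spider ls = attach (legs ls) (foot? ls)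

-- A formal power series in x₀, x₁, x₂, … is given by its truncations to the first m
-- variables, for every m: f m α is the coefficient of
-- x₀^α₀ ⋯ x₍ₘ₋₁₎^α₍ₘ₋₁₎.  Every monomial involves finitely many variables,
-- so these coefficients determine f.
Series : Set
Series = ∀ m → Vec ℕ m → ℤ

infix 4 _≈ˢ_
_≈ˢ_ : Series → Series → Set
f ≈ˢ g = ∀ m α → f m α ≡ g m α

sumℤ : List ℤ → ℤ
sumℤ = foldr ℤ._+_ 0ℤ

-- All exponent vectors β with β ≤ α componentwise.
below : ∀ {m} → Vec ℕ m → List (Vec ℕ m)
below []      = [ [] ]
below (a ∷ α) = concatMap (λ b → map (b ∷_) (below α)) (upTo (suc a))

infixl 7 _*ˢ_ _·ˢ_
_*ˢ_ : Series → Series → Series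
(f *ˢ g) m α = sumℤ (map (λ β → f m β ℤ.* g m (zipWith _∸_ α β)) (below α))

_·ˢ_ : ℤ → Series → Series
(c ·ˢ f) m α = c ℤ.* f m α

Σˢ[_]_ : {A : Set} → List A → (A → Series) → Series
(Σˢ[ xs ] f) m α = sumℤ (map (λ x → f x m α) xs)

-- The k-th elementary symmetric function, the sum of all squarefree monomials
-- of degree k.  In particular 𝑒 0 is the unit series.
𝑒 : ℕ → Series
𝑒 k m α = if does (Vec.all? (ℕ._≤? 1) α ×-dec (sum α ℕ.≟ k)) then 1ℤ else 0ℤ

record Partition : Set where
  field
    parts      : List ℕ
    positive   : All (1 ≤_) parts
    decreasing : Linked _≥_ parts

𝑒[_] : Partition → Series
𝑒[ μ ] = foldr (λ k f → 𝑒 k *ˢ f) (𝑒 0) (Partition.parts μ)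

-- An expansion of f in the basis (𝑒[ μ ])_μ of the ring of symmetric functions.
-- This is a basis over ℤ, so integral coefficients suffice for integral f.
record 𝑒-Expansion (f : Series) : Set where
  field
    support  : List Partition
    unique   : Unique support
    coeff    : Partition → ℤ
    expands  : f ≈ˢ Σˢ[ support ] (λ μ → coeff μ ·ˢ 𝑒[ μ ])

𝑒-Positive : Series → Set
𝑒-Positive f = ∃ λ (E : 𝑒-Expansion f) →
  let open 𝑒-Expansion E in All (λ μ → 0ℤ ℤ.≤ coeff μ) support

module _ (G : Graph) where
  open Graph G using (_~_; _~?_) renaming (order to n)

  Colouring : ℕ → Set
  Colouring m = Vec (Fin m) n

  Proper : ∀ {m} → Pred (Colouring m) 0ℓ
  Proper κ = ∀ u v → u ~ v → lookup κ u ≢ lookup κ v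

  proper? : ∀ {m} → Unary.Decidable (Proper {m})
  proper? κ = Fin.all? λ u → Fin.all? λ v →
    (u ~? v) →-dec ¬? (lookup κ u Fin.≟ lookup κ v)

-- The exponent vector of the monomial ∏ᵥ x_κ(v).
content : ∀ {m n} → Vec (Fin m) n → Vec ℕ m
content κ = tabulate λ i → count (Fin._≟ i) κ

words : ∀ m n → List (Vec (Fin m) n)
words m zero    = [ [] ]
words m (suc n) = concatMap (λ i → map (i ∷_) (words m n)) (allFin m)

-- X_G = ∑_κ ∏ᵥ x_κ(v) over the proper colourings κ of G: the coefficient of x^α
-- is the number of proper colourings with content α.
chromatic : Graph → Series
chromatic G m α = + length (filter good? (words m (order G)))
  where
  good? : (κ : Colouring G m) → Dec (Proper G κ × content κ ≡ α)
  good? κ = proper? G κ ×-dec ≡-dec ℕ._≟_ (content κ) α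

𝑒-PositiveGraph : Graph → Set
𝑒-PositiveGraph G = 𝑒-Positive (chromatic G)

{-# OPTIONS --safe #-}

-- Evaluate everything at four elements x₀, …, x₃ of ℤ[ω][ε]/(ε³), ω a primitive cube root of
-- unity, chosen so that all their elementary symmetric functions lie in ℕ[ε].  Every 𝑒[ μ ],
-- hence every 𝑒-positive series, then takes a value with non-negative ε-coefficients.
--
-- Summing over the colour of the centre gives, with P n the value of the path on n vertices,
--   S(a,b,2) = P (a+b+3) + P 1 P (a+b+2) + P 2 P (a+b+1) − P (a+1) P (b+2) − P (b+1) P (a+2),
-- and ∑ P n zⁿ = E(z) / (1 − e₂z² − 2e₃z³ − 3e₄z⁴) for E(z) = ∏ (1 + xᵢz).  Taking for E(z) the
-- polynomial 1 + z³ perturbed by a term of order ε in z, z² or z⁴, the numbers P n have simple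
-- closed forms modulo ε³, and in each excluded residue class some ε-coefficient of S(a,b,2) is
-- negative.  In terms of the 𝑒-basis these are the coefficients at (3^q) for residues (1,2) and
-- (2,1), at (3^q,1) for (2,2), at (3^q,2) for (1,1) and at (4,4,3^q) for (0,2), up to positive
-- factors.

module Submission where

open import Defs
open import Algebra.Bundles using (CommutativeRing)
open import Algebra.Consequences.Propositional using (comm∧idˡ⇒id; comm∧invˡ⇒inv; comm∧distrˡ⇒distrʳ)
open import Algebra.Core using (Op₁; Op₂)
import Algebra.Definitions as Definitions
open import Algebra.Structures using (IsCommutativeRing)
open import Data.Bool.Base using (if_then_else_; true; false)
open import Data.Fin.Base using (Fin; zero; suc; toℕ; splitAt; _↑ˡ_; _↑ʳ_)
open import Data.Fin.Patterns using (0F; 1F; 2F; 3F)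
import Data.Fin.Properties as Fin
open import Data.Integer.Base using (ℤ; 0ℤ; 1ℤ; -1ℤ)
import Data.Integer.Base as ℤ
import Data.Integer.Properties as ℤ
import Data.Integer.Tactic.RingSolver as ℤSolver
open import Data.List.Base
  using (List; []; _∷_; map; concatMap; filter; foldr; length; upTo; allFin; deduplicate)
import Data.List.Base as List
open import Data.List.Membership.Propositional using (_∈_; _∉_)
open import Data.List.Membership.Propositional.Properties
  using (∈-++⁺ˡ; ∈-++⁺ʳ; ∈-concatMap⁺; ∈-deduplicate⁺; ∈-upTo⁺; ∈-upTo⁻; ∈-allFin)
open import Data.List.Relation.Unary.All using (All; []; _∷_)
import Data.List.Relation.Unary.All as All
open import Data.List.Relation.Unary.Any using (here; there)
import Data.List.Relation.Unary.Any as Any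
open import Data.List.Relation.Unary.Unique.DecPropositional.Properties using (deduplicate-!)
open import Data.List.Relation.Unary.Unique.Propositional using (Unique; []; _∷_)
open import Data.List.Relation.Unary.Unique.Propositional.Properties using (upTo⁺; allFin⁺)
open import Data.Maybe.Base using (Maybe; just; nothing)
open import Data.Nat.Base
  using (ℕ; zero; suc; _+_; _*_; _∸_; _^_; _≤_; _<_; _/_; _%_; z≤n; s≤s; s≤s⁻¹)
open import Data.Nat.DivMod using (m≡m%n+[m/n]*n; m%n<n)
import Data.Nat.Properties as ℕ
import Data.Nat.Tactic.RingSolver as ℕSolver
open import Data.Product.Base using (_×_; _,_; ∃; proj₁)
open import Data.Sum.Base using (_⊎_; inj₁; inj₂; [_,_])
open import Data.Sum.Relation.Binary.Pointwise using (Pointwise; inj₁; inj₂)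
open import Data.Vec.Base using (Vec; []; _∷_; _++_; lookup; tabulate; count; zipWith; sum)
open import Data.Vec.Properties using (≡-dec; lookup-++ˡ; lookup-++ʳ; lookup-splitAt; tabulate-cong)
import Data.Vec.Relation.Unary.All as Vec
open import Function.Base using (_∘_)
open import Function.Bundles using (_⇔_; mk⇔; module Equivalence)
open import Level using (0ℓ)
open import Relation.Binary.Definitions using (DecidableEquality)
open import Relation.Binary.PropositionalEquality
  using (_≡_; _≢_; refl; sym; trans; cong; cong₂; subst; subst₂; isEquivalence; module ≡-Reasoning)
open import Relation.Nullary.Decidable
  using (Dec; yes; no; does; _×-dec_; _→-dec_; ¬?; does-⇔; dec-true; dec-false)
open import Relation.Nullary.Negation using (contradiction; ¬_)
open import Relation.Unary using (Pred; Decidable)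
open import Tactic.RingSolver using (solve-∀)
open import Tactic.RingSolver.Core.AlmostCommutativeRing
  using (AlmostCommutativeRing; fromCommutativeRing)

open ≡-Reasoning
open Graph using (order)

-- A `Series` is a family of coefficient functions with no finiteness attached, so it cannot be
-- evaluated directly. In a fixed number of variables, however, a chromatic series and every
-- `𝑒[ μ ]` are finite multisets of monomials, and an equality of coefficients transfers to sums of
-- any function of the exponent vector over these multisets. The function used is the integer
-- component of one ε-coefficient of the value of the monomial.
--
-- The root ω is there to split 1 + z³, and this choice of E makes P n vanish to lowest order unless
-- 3 divides n. The denominator 1 - e₂z² - 2e₃z³ - 3e₄z⁴ is E(z) - zE′(z); it arises because ∑ xᵢ
-- E(z)/(1 + xᵢz) = E′(z).
--
-- Residues (0,2) force the second order in ε: there the coefficient at (3^q,2) is positive for a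
-- close to b and negative only for a large compared with b, whereas the one at (4,4,3^q) is
-- negative as soon as a ≥ b.

private variable
  k l m n : ℕ

module _ {A : Set} {_+_ _*_ : Op₂ A} { -_ : Op₁ A} {0# 1# : A} where
  open Definitions {A = A} _≡_

  mkIsCommutativeRing :
    Associative _+_ → Commutative _+_ → LeftIdentity 0# _+_ → LeftInverse 0# -_ _+_ →
    Associative _*_ → Commutative _*_ → LeftIdentity 1# _*_ → _*_ DistributesOverˡ _+_ →
    IsCommutativeRing _≡_ _+_ _*_ -_ 0# 1#
  mkIsCommutativeRing +-assoc +-comm +-idˡ +-invˡ *-assoc *-comm *-idˡ distribˡ = record
    { isRing = record
      { +-isAbelianGroup = record
        { isGroup = record
          { isMonoid = record
            { isSemigroup = record
              { isMagma = record { isEquivalence = isEquivalence ; ∙-cong = cong₂ _+_ }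
              ; assoc   = +-assoc
              }
            ; identity = comm∧idˡ⇒id +-comm +-idˡ
            }
          ; inverse = comm∧invˡ⇒inv +-comm +-invˡ
          ; ⁻¹-cong = cong -_
          }
        ; comm = +-comm
        }
      ; *-cong     = cong₂ _*_
      ; *-assoc    = *-assoc
      ; *-identity = comm∧idˡ⇒id *-comm *-idˡ
      ; distrib    = distribˡ , comm∧distrˡ⇒distrʳ *-comm distribˡ
      }
    ; *-comm = *-comm
    }

-- The ring of values

module Eisenstein where

  infix 8 _+_ω
  data ℤ[ω] : Set where
    _+_ω : ℤ → ℤ → ℤ[ω]

  infixl 6 _⊕_
  infixl 7 _⊗_
  -- The product uses ω² = -1 - ω.
  _⊕_ _⊗_ : ℤ[ω] → ℤ[ω] → ℤ[ω]
  (a + b ω) ⊕ (c + d ω) = (a ℤ.+ c) + (b ℤ.+ d) ω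
  (a + b ω) ⊗ (c + d ω) = (a ℤ.* c ℤ.- b ℤ.* d) + (a ℤ.* d ℤ.+ b ℤ.* c ℤ.- b ℤ.* d) ω

  ⊝_ : ℤ[ω] → ℤ[ω]
  ⊝ (a + b ω) = (ℤ.- a) + (ℤ.- b) ω

  𝟎 𝟏 : ℤ[ω]
  𝟎 = 0ℤ + 0ℤ ω
  𝟏 = 1ℤ + 0ℤ ω

  isCommutativeRing : IsCommutativeRing _≡_ _⊕_ _⊗_ ⊝_ 𝟎 𝟏
  isCommutativeRing = mkIsCommutativeRing
    (λ { (a + b ω) (c + d ω) (e + f ω) → cong₂ _+_ω (ℤ.+-assoc a c e) (ℤ.+-assoc b d f) })
    (λ { (a + b ω) (c + d ω) → cong₂ _+_ω (ℤ.+-comm a c) (ℤ.+-comm b d) })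
    (λ { (a + b ω) → cong₂ _+_ω (ℤ.+-identityˡ a) (ℤ.+-identityˡ b) })
    (λ { (a + b ω) → cong₂ _+_ω (ℤ.+-inverseˡ a) (ℤ.+-inverseˡ b) })
    (λ { (a + b ω) (c + d ω) (e + f ω) → cong₂ _+_ω (assoc-re a b c d e f) (assoc-im a b c d e f) })
    (λ { (a + b ω) (c + d ω) → cong₂ _+_ω (comm-re a b c d) (comm-im a b c d) })
    (λ { (a + b ω) → cong₂ _+_ω (id-re a b) (id-im a b) })
    (λ { (a + b ω) (c + d ω) (e + f ω) → cong₂ _+_ω (distrib-re a b c d e f)
      (distrib-im a b c d e f) })
    where
    assoc-re : ∀ a b c d e f → (a ℤ.* c ℤ.- b ℤ.* d) ℤ.* e ℤ.- (a ℤ.* d ℤ.+ b ℤ.* c ℤ.- b ℤ.* d)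
      ℤ.* f ≡ a ℤ.* (c ℤ.* e ℤ.- d ℤ.* f) ℤ.- b ℤ.* (c ℤ.* f ℤ.+ d ℤ.* e ℤ.- d ℤ.* f)
    assoc-re = ℤSolver.solve-∀
    assoc-im : ∀ a b c d e f → (a ℤ.* c ℤ.- b ℤ.* d) ℤ.* f ℤ.+ (a ℤ.* d ℤ.+ b ℤ.* c ℤ.- b ℤ.* d)
      ℤ.* e ℤ.- (a ℤ.* d ℤ.+ b ℤ.* c ℤ.- b ℤ.* d) ℤ.* f
      ≡ a ℤ.* (c ℤ.* f ℤ.+ d ℤ.* e ℤ.- d ℤ.* f) ℤ.+ b ℤ.* (c ℤ.* e ℤ.- d ℤ.* f) ℤ.- b ℤ.*
        (c ℤ.* f ℤ.+ d ℤ.* e ℤ.- d ℤ.* f)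
    assoc-im = ℤSolver.solve-∀
    id-re : ∀ a b → 1ℤ ℤ.* a ℤ.- 0ℤ ℤ.* b ≡ a
    id-re = ℤSolver.solve-∀
    id-im : ∀ a b → 1ℤ ℤ.* b ℤ.+ 0ℤ ℤ.* a ℤ.- 0ℤ ℤ.* b ≡ b
    id-im = ℤSolver.solve-∀
    distrib-re : ∀ a b c d e f → a ℤ.* (c ℤ.+ e) ℤ.- b ℤ.* (d ℤ.+ f) ≡ (a ℤ.* c ℤ.- b ℤ.* d) ℤ.+
      (a ℤ.* e ℤ.- b ℤ.* f)
    distrib-re = ℤSolver.solve-∀
    distrib-im : ∀ a b c d e f → a ℤ.* (d ℤ.+ f) ℤ.+ b ℤ.* (c ℤ.+ e) ℤ.- b ℤ.* (d ℤ.+ f) ≡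
      (a ℤ.* d ℤ.+ b ℤ.* c ℤ.- b ℤ.* d) ℤ.+ (a ℤ.* f ℤ.+ b ℤ.* e ℤ.- b ℤ.* f)
    distrib-im = ℤSolver.solve-∀
    comm-re : ∀ a b c d → a ℤ.* c ℤ.- b ℤ.* d ≡ c ℤ.* a ℤ.- d ℤ.* b
    comm-re = ℤSolver.solve-∀
    comm-im : ∀ a b c d → a ℤ.* d ℤ.+ b ℤ.* c ℤ.- b ℤ.* d ≡ c ℤ.* b ℤ.+ d ℤ.* a ℤ.- d ℤ.* b
    comm-im = ℤSolver.solve-∀

  𝟎? : ∀ x → Maybe (𝟎 ≡ x)
  𝟎? ((ℤ.+ 0) + (ℤ.+ 0) ω) = just refl
  𝟎? _ = nothing

  ring : AlmostCommutativeRing 0ℓ 0ℓ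
  ring = fromCommutativeRing (record { isCommutativeRing = isCommutativeRing }) 𝟎?

module Truncated where
  open Eisenstein using (ℤ[ω]; 𝟎; 𝟏; 𝟎?)
    renaming (_⊕_ to infixl 6 _+ᴱ_; _⊗_ to infixl 7 _*ᴱ_)
  private module E = IsCommutativeRing Eisenstein.isCommutativeRing

  -- ⟨ a , b , c ⟩ is a + bε + cε², with ε³ = 0.
  data ℤ[ω,ε] : Set where
    ⟨_,_,_⟩ : ℤ[ω] → ℤ[ω] → ℤ[ω] → ℤ[ω,ε]

  ext : ∀ {a b c a′ b′ c′} → a ≡ a′ → b ≡ b′ → c ≡ c′ → ⟨ a , b , c ⟩ ≡ ⟨ a′ , b′ , c′ ⟩
  ext refl refl refl = refl

  infixl 6 _⊕_
  infixl 7 _⊗_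
  _⊕_ _⊗_ : ℤ[ω,ε] → ℤ[ω,ε] → ℤ[ω,ε]
  ⟨ a , b , c ⟩ ⊕ ⟨ d , e , f ⟩ = ⟨ a +ᴱ d , b +ᴱ e , c +ᴱ f ⟩
  ⟨ a , b , c ⟩ ⊗ ⟨ d , e , f ⟩ = ⟨ a *ᴱ d , a *ᴱ e +ᴱ b *ᴱ d , a *ᴱ f +ᴱ b *ᴱ e +ᴱ c *ᴱ d ⟩

  ⊝_ : ℤ[ω,ε] → ℤ[ω,ε]
  ⊝ ⟨ a , b , c ⟩ = ⟨ Eisenstein.⊝ a , Eisenstein.⊝ b , Eisenstein.⊝ c ⟩

  assoc₁ : ∀ a b d e g h → (a *ᴱ d) *ᴱ h +ᴱ (a *ᴱ e +ᴱ b *ᴱ d) *ᴱ g ≡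
    a *ᴱ (d *ᴱ h +ᴱ e *ᴱ g) +ᴱ b *ᴱ (d *ᴱ g)
  assoc₁ = solve-∀ Eisenstein.ring
  assoc₂ : ∀ a b c d e f g h i →
    (a *ᴱ d) *ᴱ i +ᴱ (a *ᴱ e +ᴱ b *ᴱ d) *ᴱ h +ᴱ (a *ᴱ f +ᴱ b *ᴱ e +ᴱ c *ᴱ d) *ᴱ g ≡
    a *ᴱ (d *ᴱ i +ᴱ e *ᴱ h +ᴱ f *ᴱ g) +ᴱ b *ᴱ (d *ᴱ h +ᴱ e *ᴱ g) +ᴱ c *ᴱ (d *ᴱ g)
  assoc₂ = solve-∀ Eisenstein.ring
  comm₁ : ∀ a b d e → a *ᴱ e +ᴱ b *ᴱ d ≡ d *ᴱ b +ᴱ e *ᴱ a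
  comm₁ = solve-∀ Eisenstein.ring
  comm₂ : ∀ a b c d e f → a *ᴱ f +ᴱ b *ᴱ e +ᴱ c *ᴱ d ≡ d *ᴱ c +ᴱ e *ᴱ b +ᴱ f *ᴱ a
  comm₂ = solve-∀ Eisenstein.ring
  id₁ : ∀ a b → 𝟏 *ᴱ b +ᴱ 𝟎 *ᴱ a ≡ b
  id₁ = solve-∀ Eisenstein.ring
  id₂ : ∀ a b c → 𝟏 *ᴱ c +ᴱ 𝟎 *ᴱ b +ᴱ 𝟎 *ᴱ a ≡ c
  id₂ = solve-∀ Eisenstein.ring
  distrib₁ : ∀ a b d e g h → a *ᴱ (e +ᴱ h) +ᴱ b *ᴱ (d +ᴱ g) ≡ (a *ᴱ e +ᴱ b *ᴱ d) +ᴱ (a *ᴱ h +ᴱ b *ᴱ g)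
  distrib₁ = solve-∀ Eisenstein.ring
  distrib₂ : ∀ a b c d e f g h i → a *ᴱ (f +ᴱ i) +ᴱ b *ᴱ (e +ᴱ h) +ᴱ c *ᴱ (d +ᴱ g) ≡
      (a *ᴱ f +ᴱ b *ᴱ e +ᴱ c *ᴱ d) +ᴱ (a *ᴱ i +ᴱ b *ᴱ h +ᴱ c *ᴱ g)
  distrib₂ = solve-∀ Eisenstein.ring

  isCommutativeRing : IsCommutativeRing _≡_ _⊕_ _⊗_ ⊝_ ⟨ 𝟎 , 𝟎 , 𝟎 ⟩ ⟨ 𝟏 , 𝟎 , 𝟎 ⟩
  isCommutativeRing = mkIsCommutativeRing
    (λ { (⟨ a , b , c ⟩) (⟨ d , e , f ⟩) (⟨ g , h , i ⟩) → ext (E.+-assoc a d g) (E.+-assoc b e h)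
      (E.+-assoc c f i) })
    (λ { (⟨ a , b , c ⟩) (⟨ d , e , f ⟩) → ext (E.+-comm a d) (E.+-comm b e) (E.+-comm c f) })
    (λ { (⟨ a , b , c ⟩) → ext (E.+-identityˡ a) (E.+-identityˡ b) (E.+-identityˡ c) })
    (λ { (⟨ a , b , c ⟩) → ext (E.-‿inverseˡ a) (E.-‿inverseˡ b) (E.-‿inverseˡ c) })
    (λ { (⟨ a , b , c ⟩) (⟨ d , e , f ⟩) (⟨ g , h , i ⟩) → ext (E.*-assoc a d g)
      (assoc₁ a b d e g h) (assoc₂ a b c d e f g h i) })
    (λ { (⟨ a , b , c ⟩) (⟨ d , e , f ⟩) → ext (E.*-comm a d) (comm₁ a b d e) (comm₂ a b c d e f) })
    (λ { (⟨ a , b , c ⟩) → ext (E.*-identityˡ a) (id₁ a b) (id₂ a b c) })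
    (λ { (⟨ a , b , c ⟩) (⟨ d , e , f ⟩) (⟨ g , h , i ⟩) → ext (E.distribˡ a d g)
      (distrib₁ a b d e g h) (distrib₂ a b c d e f g h i) })

  0? : ∀ x → Maybe (⟨ 𝟎 , 𝟎 , 𝟎 ⟩ ≡ x)
  0? ⟨ a , b , c ⟩ with 𝟎? a | 𝟎? b | 𝟎? c
  ... | just refl | just refl | just refl = just refl
  ... | _ | _ | _ = nothing

  ring : AlmostCommutativeRing 0ℓ 0ℓ
  ring = fromCommutativeRing (record { isCommutativeRing = isCommutativeRing }) 0?

-- Finite sums

module Sum {A : Set} {_+_ _*_ : Op₂ A} { -_ : Op₁ A} {0# 1# : A}
           (isCommutativeRing : IsCommutativeRing _≡_ _+_ _*_ -_ 0# 1#) where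

  private
    module R = IsCommutativeRing isCommutativeRing
    commutativeRing : CommutativeRing 0ℓ 0ℓ
    commutativeRing = record { isCommutativeRing = isCommutativeRing }
    variable
      X Y P Q : Set
      x y : X
      f g : X → A
      xs ys : List X

  open import Algebra.Properties.CommutativeSemigroup
    (CommutativeRing.+-commutativeSemigroup commutativeRing)
    using (interchange)

  open ≡-Reasoning

  ∑ : List X → (X → A) → A
  ∑ xs f = foldr _+_ 0# (map f xs)

  infixr 5 ∑
  syntax ∑ xs (λ x → e) = ∑[ x ∈ xs ] e

  ∑-cong-∈ : (∀ x → x ∈ xs → f x ≡ g x) → ∑ xs f ≡ ∑ xs g
  ∑-cong-∈ {xs = []}     eq = refl
  ∑-cong-∈ {xs = x ∷ xs} eq = cong₂ _+_ (eq x (here refl)) (∑-cong-∈ λ y → eq y ∘ there)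

  ∑-cong : (∀ x → f x ≡ g x) → ∀ xs → ∑ xs f ≡ ∑ xs g
  ∑-cong eq xs = ∑-cong-∈ {xs = xs} λ x _ → eq x

  ∑-++ : ∀ (f : X → A) xs ys → ∑ (xs List.++ ys) f ≡ (∑ xs f) + (∑ ys f)
  ∑-++ f []       ys = sym (R.+-identityˡ _)
  ∑-++ f (x ∷ xs) ys = trans (cong (f x +_) (∑-++ f xs ys)) (sym (R.+-assoc _ _ _))

  ∑-map : ∀ (f : Y → A) (h : X → Y) xs → ∑ (map h xs) f ≡ ∑ xs (f ∘ h)
  ∑-map f h []       = refl
  ∑-map f h (x ∷ xs) = cong (f (h x) +_) (∑-map f h xs)

  ∑-concatMap : ∀ (f : Y → A) (h : X → List Y) xs → ∑ (concatMap h xs) f ≡ ∑[ x ∈ xs ] ∑ (h x) f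
  ∑-concatMap f h []       = refl
  ∑-concatMap f h (x ∷ xs) =
    trans (∑-++ f (h x) (concatMap h xs)) (cong (∑ (h x) f +_) (∑-concatMap f h xs))

  ∑-0 : ∀ (xs : List X) → ∑[ x ∈ xs ] 0# ≡ 0#
  ∑-0 []       = refl
  ∑-0 (x ∷ xs) = trans (R.+-identityˡ _) (∑-0 xs)

  ∑-+ : ∀ (f g : X → A) xs → ∑[ x ∈ xs ] (f x + g x) ≡ (∑ xs f) + (∑ xs g)
  ∑-+ f g []       = sym (R.+-identityˡ _)
  ∑-+ f g (x ∷ xs) = trans (cong ((f x + g x) +_) (∑-+ f g xs)) (interchange _ _ _ _)

  ∑-*ˡ : ∀ c (f : X → A) xs → ∑[ x ∈ xs ] (c * f x) ≡ c * (∑ xs f)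
  ∑-*ˡ c f []       = sym (R.zeroʳ c)
  ∑-*ˡ c f (x ∷ xs) = trans (cong ((c * f x) +_) (∑-*ˡ c f xs)) (sym (R.distribˡ c _ _))

  ∑-*ʳ : ∀ c (f : X → A) xs → ∑[ x ∈ xs ] (f x * c) ≡ (∑ xs f) * c
  ∑-*ʳ c f xs = trans (∑-cong (λ x → R.*-comm (f x) c) xs) (trans (∑-*ˡ c f xs) (R.*-comm c _))

  ∑-*-∑ : ∀ (f : X → A) (g : Y → A) xs ys →
    (∑ xs f) * (∑ ys g) ≡ ∑[ x ∈ xs ] ∑[ y ∈ ys ] (f x * g y)
  ∑-*-∑ f g xs ys = sym (trans (∑-cong (λ x → ∑-*ˡ (f x) g ys) xs) (∑-*ʳ _ f xs))

  ∑-swap : ∀ (f : X → Y → A) xs ys → ∑[ x ∈ xs ] ∑[ y ∈ ys ] f x y ≡ ∑[ y ∈ ys ] ∑[ x ∈ xs ] f x y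
  ∑-swap f []       ys = sym (∑-0 ys)
  ∑-swap f (x ∷ xs) ys = trans (cong (∑ ys (f x) +_) (∑-swap f xs ys)) (sym (∑-+ _ _ ys))

  χ : Dec P → A
  χ d = if does d then 1# else 0#

  χ-true : (d : Dec P) → P → χ d ≡ 1#
  χ-true d p = cong (if_then 1# else 0#) (dec-true d p)

  χ-false : (d : Dec P) → ¬ P → χ d ≡ 0#
  χ-false d ¬p = cong (if_then 1# else 0#) (dec-false d ¬p)

  χ-⇔ : P ⇔ Q → (p? : Dec P) (q? : Dec Q) → χ p? ≡ χ q?
  χ-⇔ P⇔Q p? q? = cong (if_then 1# else 0#) (does-⇔ P⇔Q p? q?)

  χ-× : (p? : Dec P) (q? : Dec Q) → χ (p? ×-dec q?) ≡ χ p? * χ q?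
  χ-× p? q? with does p?
  ... | true  = sym (R.*-identityˡ _)
  ... | false = sym (R.zeroˡ _)

  ∑-filter : ∀ {p} {P : Pred X p} (P? : Decidable P) (f : X → A) xs →
    ∑ (filter P? xs) f ≡ ∑[ x ∈ xs ] ((if does (P? x) then 1# else 0#) * f x)
  ∑-filter P? f []       = refl
  ∑-filter P? f (x ∷ xs) with does (P? x)
  ... | true  = cong₂ _+_ (sym (R.*-identityˡ _)) (∑-filter P? f xs)
  ... | false = trans (∑-filter P? f xs) (sym (trans (cong₂ _+_ (R.zeroˡ _) refl) (R.+-identityˡ _)))

  module _ (_≟_ : DecidableEquality X) (h : X → A) where

    ∑-δ-∉ : ∀ {x xs} → x ∉ xs → ∑[ y ∈ xs ] (χ (x ≟ y) * h y) ≡ 0#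
    ∑-δ-∉ {x} {xs} x∉xs = trans (∑-cong-∈ {xs = xs} λ y y∈xs →
      trans (cong (_* h y) (χ-false (x ≟ y) λ { refl → x∉xs y∈xs })) (R.zeroˡ _)) (∑-0 xs)

    ∑-δ : ∀ {x xs} → Unique xs → x ∈ xs → ∑[ y ∈ xs ] (χ (x ≟ y) * h y) ≡ h x
    ∑-δ {x} {_ ∷ xs} (x∉xs ∷ xs!) (here refl) = begin
      (χ (x ≟ x) * h x) + (∑[ y ∈ xs ] (χ (x ≟ y) * h y))
        ≡⟨ cong₂ _+_ (cong (_* h x) (χ-true (x ≟ x) refl))
          (∑-δ-∉ λ x∈xs → All.lookup x∉xs x∈xs refl) ⟩
      (1# * h x) + 0#  ≡⟨ R.+-identityʳ _ ⟩
      1# * h x         ≡⟨ R.*-identityˡ _ ⟩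
      h x              ∎
    ∑-δ {x} {y ∷ xs} (y∉xs ∷ xs!) (there x∈xs) = begin
      (χ (x ≟ y) * h y) + (∑[ y ∈ xs ] (χ (x ≟ y) * h y))
        ≡⟨ cong₂ _+_ (cong (_* h y) (χ-false (x ≟ y) λ { refl → All.lookup y∉xs x∈xs refl }))
          (∑-δ xs! x∈xs) ⟩
      (0# * h y) + h x  ≡⟨ cong (_+ h x) (R.zeroˡ _) ⟩
      0# + h x          ≡⟨ R.+-identityˡ _ ⟩
      h x               ∎

-- 𝑒-expansions and multisets of monomials

module ∑ℤ = Sum ℤ.+-*-isCommutativeRing

module Multiplicities where
  open ∑ℤ

  infix 4 _≟ᵛ_
  _≟ᵛ_ : DecidableEquality (Vec ℕ m)
  _≟ᵛ_ = ≡-dec ℕ._≟_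

  -- A series restricted to m variables is represented by the list of its monomials, with repetition.
  mult : List (Vec ℕ m) → Vec ℕ m → ℤ
  mult L α = ∑[ β ∈ L ] χ (β ≟ᵛ α)

  -- The keys may exceed the entries of L, so that several lists can be compared over one common set
  -- of exponent vectors.
  ∑-by-mult : ∀ {keys L : List (Vec ℕ m)} → Unique keys → (∀ {β} → β ∈ L → β ∈ keys) →
    ∀ (g : Vec ℕ m → ℤ) → ∑ L g ≡ ∑[ α ∈ keys ] (mult L α ℤ.* g α)
  ∑-by-mult {keys = keys} {L} keys! L⊆keys g = sym (begin
    ∑[ α ∈ keys ] (mult L α ℤ.* g α)                  ≡⟨ ∑-cong (λ α → ∑-*ʳ (g α) _ L) keys ⟨
    ∑[ α ∈ keys ] ∑[ β ∈ L ] (χ (β ≟ᵛ α) ℤ.* g α)     ≡⟨ ∑-swap _ keys L ⟩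
    ∑[ β ∈ L ] ∑[ α ∈ keys ] (χ (β ≟ᵛ α) ℤ.* g α)
      ≡⟨ ∑-cong-∈ {xs = L} (λ β β∈L → ∑-δ _≟ᵛ_ g keys! (L⊆keys β∈L)) ⟩
    ∑ L g                                             ∎)

  Represents : Series → ∀ {m} → List (Vec ℕ m) → Set
  Represents f {m} L = ∀ α → f m α ≡ mult L α

  infixr 7 _⊛_
  _⊛_ : List (Vec ℕ m) → List (Vec ℕ m) → List (Vec ℕ m)
  L ⊛ M = concatMap (λ β → map (zipWith _+_ β) M) L

  ∑-⊛ : ∀ (g : Vec ℕ m → ℤ) L M → ∑ (L ⊛ M) g ≡ ∑[ β ∈ L ] ∑[ γ ∈ M ] g (zipWith _+_ β γ)
  ∑-⊛ g L M = trans (∑-concatMap g _ L) (∑-cong (λ β → ∑-map g (zipWith _+_ β) M) L)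

  -- Only d = b can contribute, and it lies in `upTo (suc a)` exactly when b ≤ a. In that range the
  -- truncated subtraction `a ∸ d` is exact.
  ∑-upTo-split : ∀ a b c → ∑[ d ∈ upTo (suc a) ] (χ (b ℕ.≟ d) ℤ.* χ (c ℕ.≟ a ∸ d)) ≡ χ (b + c ℕ.≟ a)
  ∑-upTo-split a b c with b ℕ.≤? a
  ... | yes b≤a = trans (∑-δ ℕ._≟_ (λ d → χ (c ℕ.≟ a ∸ d)) (upTo⁺ (suc a)) (∈-upTo⁺ (s≤s b≤a)))
    (χ-⇔ (mk⇔ (λ { refl → ℕ.m+[n∸m]≡n b≤a }) (λ { refl → sym (ℕ.m+n∸m≡n b c) })) (c ℕ.≟ a ∸ b)
      (b + c ℕ.≟ a))
  ... | no  b≰a = trans (∑-δ-∉ ℕ._≟_ (λ d → χ (c ℕ.≟ a ∸ d)) (λ b∈ → b≰a (s≤s⁻¹ (∈-upTo⁻ b∈))))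
    (sym (χ-false (b + c ℕ.≟ a) λ { refl → b≰a (ℕ.m≤m+n b c) }))

  ∑-below-split : ∀ (α β γ : Vec ℕ m) →
    ∑[ δ ∈ below α ] (χ (β ≟ᵛ δ) ℤ.* χ (γ ≟ᵛ zipWith _∸_ α δ)) ≡ χ (zipWith _+_ β γ ≟ᵛ α)
  ∑-below-split []      []      []      = refl
  ∑-below-split (a ∷ α) (b ∷ β) (c ∷ γ) = begin
    ∑ (below (a ∷ α)) F
      ≡⟨ ∑-concatMap F (λ d → map (d ∷_) (below α)) (upTo (suc a)) ⟩
    ∑[ d ∈ upTo (suc a) ] ∑ (map (d ∷_) (below α)) F
      ≡⟨ ∑-cong (λ d → ∑-map F (d ∷_) (below α)) (upTo (suc a)) ⟩
    ∑[ d ∈ upTo (suc a) ] ∑[ δ ∈ below α ] F (d ∷ δ)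
      ≡⟨ ∑-cong (λ d → ∑-cong (λ δ → F-∷ d δ) (below α)) (upTo (suc a)) ⟩
    ∑[ d ∈ upTo (suc a) ] ∑[ δ ∈ below α ] (F₁ d ℤ.* F₂ δ)
      ≡⟨ ∑-*-∑ F₁ F₂ (upTo (suc a)) (below α) ⟨
    ∑ (upTo (suc a)) F₁ ℤ.* ∑ (below α) F₂
      ≡⟨ cong₂ ℤ._*_ (∑-upTo-split a b c) (∑-below-split α β γ) ⟩
    χ (b + c ℕ.≟ a) ℤ.* χ (zipWith _+_ β γ ≟ᵛ α)
      ≡⟨ χ-× (b + c ℕ.≟ a) (zipWith _+_ β γ ≟ᵛ α) ⟨
    χ (zipWith _+_ (b ∷ β) (c ∷ γ) ≟ᵛ a ∷ α)  ∎
    where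
    open import Algebra.Properties.CommutativeSemigroup ℤ.*-commutativeSemigroup using (interchange)
    F : Vec ℕ (suc _) → ℤ
    F δ = χ (b ∷ β ≟ᵛ δ) ℤ.* χ (c ∷ γ ≟ᵛ zipWith _∸_ (a ∷ α) δ)
    F₁ : ℕ → ℤ
    F₁ d = χ (b ℕ.≟ d) ℤ.* χ (c ℕ.≟ a ∸ d)
    F₂ : Vec ℕ _ → ℤ
    F₂ δ = χ (β ≟ᵛ δ) ℤ.* χ (γ ≟ᵛ zipWith _∸_ α δ)
    F-∷ : ∀ d δ → F (d ∷ δ) ≡ F₁ d ℤ.* F₂ δ
    F-∷ d δ = trans (cong₂ ℤ._*_ (χ-× (b ℕ.≟ d) (β ≟ᵛ δ)) (χ-× (c ℕ.≟ a ∸ d) (γ ≟ᵛ zipWith _∸_ α δ)))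
      (interchange (χ (b ℕ.≟ d)) _ _ _)

  *ˢ-represents : ∀ f g {L M : List (Vec ℕ m)} → Represents f L → Represents g M →
    Represents (f *ˢ g) (L ⊛ M)
  *ˢ-represents f g {L} {M} fL gM α = begin
    (∑[ δ ∈ below α ] (f _ δ ℤ.* g _ (zipWith _∸_ α δ)))
      ≡⟨ ∑-cong (λ δ → trans (cong₂ ℤ._*_ (fL δ) (gM (zipWith _∸_ α δ))) (∑-*-∑ _ _ L M)) (below α) ⟩
    (∑[ δ ∈ below α ] ∑[ β ∈ L ] ∑[ γ ∈ M ] F β γ δ)
      ≡⟨ ∑-swap _ (below α) L ⟩
    (∑[ β ∈ L ] ∑[ δ ∈ below α ] ∑[ γ ∈ M ] F β γ δ)
      ≡⟨ ∑-cong (λ β → ∑-swap _ (below α) M) L ⟩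
    (∑[ β ∈ L ] ∑[ γ ∈ M ] ∑[ δ ∈ below α ] F β γ δ)
      ≡⟨ ∑-cong (λ β → ∑-cong (λ γ → ∑-below-split α β γ) M) L ⟩
    (∑[ β ∈ L ] ∑[ γ ∈ M ] χ (zipWith _+_ β γ ≟ᵛ α))
      ≡⟨ ∑-⊛ _ L M ⟨
    mult (L ⊛ M) α ∎
    where
    F : Vec ℕ _ → Vec ℕ _ → Vec ℕ _ → ℤ
    F β γ δ = χ (β ≟ᵛ δ) ℤ.* χ (γ ≟ᵛ zipWith _∸_ α δ)

  squarefree : ∀ m → ℕ → List (Vec ℕ m)
  squarefree zero    zero    = [] ∷ []
  squarefree zero    (suc k) = []
  squarefree (suc m) zero    = map (0 ∷_) (squarefree m zero)
  squarefree (suc m) (suc k) = map (0 ∷_) (squarefree m (suc k)) List.++ map (1 ∷_) (squarefree m k)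

  mult-∷ : ∀ b a L (α : Vec ℕ m) → mult (map (b ∷_) L) (a ∷ α) ≡ χ (b ℕ.≟ a) ℤ.* mult L α
  mult-∷ b a L α = trans (∑-map _ (b ∷_) L)
    (trans (∑-cong (λ β → χ-× (b ℕ.≟ a) (β ≟ᵛ α)) L) (∑-*ˡ (χ (b ℕ.≟ a)) _ L))

  IsSquarefree : ℕ → Vec ℕ m → Set
  IsSquarefree k α = Vec.All (_≤ 1) α × sum α ≡ k

  isSquarefree? : ∀ k (α : Vec ℕ m) → Dec (IsSquarefree k α)
  isSquarefree? k α = Vec.all? (ℕ._≤? 1) α ×-dec (sum α ℕ.≟ k)

  squarefree-0∷ : ∀ {α : Vec ℕ m} → IsSquarefree k (0 ∷ α) ⇔ IsSquarefree k α
  squarefree-0∷ = mk⇔ (λ { (_ Vec.∷ p , q) → p , q }) (λ { (p , q) → z≤n Vec.∷ p , q })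

  squarefree-1∷ : ∀ {α : Vec ℕ m} → IsSquarefree (suc k) (1 ∷ α) ⇔ IsSquarefree k α
  squarefree-1∷ = mk⇔ (λ { (_ Vec.∷ p , q) → p , ℕ.suc-injective q })
                      (λ { (p , q) → s≤s z≤n Vec.∷ p , cong suc q })

  𝑒-represents : ∀ m k → Represents (𝑒 k) (squarefree m k)
  𝑒-represents zero    zero    [] = refl
  𝑒-represents zero    (suc k) [] = refl
  𝑒-represents (suc m) zero    (zero ∷ α) = begin
    χ (isSquarefree? 0 (0 ∷ α))
      ≡⟨ χ-⇔ squarefree-0∷ (isSquarefree? 0 (0 ∷ α)) (isSquarefree? 0 α) ⟩
    χ (isSquarefree? 0 α)                        ≡⟨ 𝑒-represents m 0 α ⟩
    mult (squarefree m 0) α                      ≡⟨ ℤ.*-identityˡ _ ⟨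
    1ℤ ℤ.* mult (squarefree m 0) α               ≡⟨ mult-∷ 0 0 (squarefree m 0) α ⟨
    mult (map (0 ∷_) (squarefree m 0)) (0 ∷ α)   ∎
  𝑒-represents (suc m) zero    (suc a ∷ α) = begin
    χ (isSquarefree? 0 (suc a ∷ α))                  ≡⟨ χ-false (isSquarefree? 0 (suc a ∷ α)) (λ ()) ⟩
    0ℤ                                               ≡⟨ ℤ.*-zeroˡ (mult (squarefree m 0) α) ⟨
    0ℤ ℤ.* mult (squarefree m 0) α                   ≡⟨ mult-∷ 0 (suc a) (squarefree m 0) α ⟨
    mult (map (0 ∷_) (squarefree m 0)) (suc a ∷ α)   ∎
  𝑒-represents (suc m) (suc k) (a ∷ α) = trans (split a) (sym (begin
    mult (squarefree (suc m) (suc k)) (a ∷ α)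
      ≡⟨ ∑-++ _ (map (0 ∷_) (squarefree m (suc k))) _ ⟩
    mult (map (0 ∷_) (squarefree m (suc k))) (a ∷ α) ℤ.+ mult (map (1 ∷_) (squarefree m k)) (a ∷ α)
      ≡⟨ cong₂ ℤ._+_ (mult-∷ 0 a (squarefree m (suc k)) α) (mult-∷ 1 a (squarefree m k) α) ⟩
    χ (0 ℕ.≟ a) ℤ.* mult (squarefree m (suc k)) α ℤ.+ χ (1 ℕ.≟ a) ℤ.* mult (squarefree m k) α
      ≡⟨ cong₂ (λ s t → χ (0 ℕ.≟ a) ℤ.* s ℤ.+ χ (1 ℕ.≟ a) ℤ.* t) (𝑒-represents m (suc k) α)
        (𝑒-represents m k α) ⟨
    χ (0 ℕ.≟ a) ℤ.* s₀ ℤ.+ χ (1 ℕ.≟ a) ℤ.* s₁ ∎))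
    where
    s₀ = χ (isSquarefree? (suc k) α)
    s₁ = χ (isSquarefree? k α)
    split : ∀ a → χ (isSquarefree? (suc k) (a ∷ α)) ≡ χ (0 ℕ.≟ a) ℤ.* s₀ ℤ.+ χ (1 ℕ.≟ a) ℤ.* s₁
    split 0 = begin
      χ (isSquarefree? (suc k) (0 ∷ α))
        ≡⟨ χ-⇔ squarefree-0∷ (isSquarefree? (suc k) (0 ∷ α)) (isSquarefree? (suc k) α) ⟩
      s₀                                  ≡⟨ ℤ.*-identityˡ s₀ ⟨
      1ℤ ℤ.* s₀                           ≡⟨ ℤ.+-identityʳ _ ⟨
      1ℤ ℤ.* s₀ ℤ.+ 0ℤ                    ≡⟨ cong (λ s → 1ℤ ℤ.* s₀ ℤ.+ s) (ℤ.*-zeroˡ s₁) ⟨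
      1ℤ ℤ.* s₀ ℤ.+ 0ℤ ℤ.* s₁             ∎
    split 1 = begin
      χ (isSquarefree? (suc k) (1 ∷ α))
        ≡⟨ χ-⇔ squarefree-1∷ (isSquarefree? (suc k) (1 ∷ α)) (isSquarefree? k α) ⟩
      s₁                                  ≡⟨ ℤ.*-identityˡ s₁ ⟨
      1ℤ ℤ.* s₁                           ≡⟨ ℤ.+-identityˡ _ ⟨
      0ℤ ℤ.+ 1ℤ ℤ.* s₁                    ≡⟨ cong (λ s → s ℤ.+ 1ℤ ℤ.* s₁) (ℤ.*-zeroˡ s₀) ⟨
      0ℤ ℤ.* s₀ ℤ.+ 1ℤ ℤ.* s₁             ∎
    split (suc (suc a)) = begin
      χ (isSquarefree? (suc k) (suc (suc a) ∷ α))
        ≡⟨ χ-false (isSquarefree? (suc k) (suc (suc a) ∷ α)) (λ { (s≤s () Vec.∷ _ , _) }) ⟩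
      0ℤ                                            ≡⟨ cong₂ ℤ._+_ (ℤ.*-zeroˡ s₀) (ℤ.*-zeroˡ s₁) ⟨
      0ℤ ℤ.* s₀ ℤ.+ 0ℤ ℤ.* s₁                       ∎

  𝑒-monomials : ∀ m → List ℕ → List (Vec ℕ m)
  𝑒-monomials m = foldr (λ k L → squarefree m k ⊛ L) (squarefree m 0)

  𝑒[]-represents : ∀ m μ → Represents 𝑒[ μ ] (𝑒-monomials m (Partition.parts μ))
  𝑒[]-represents m μ = go (Partition.parts μ)
    where
    go : ∀ ks → Represents (foldr (λ k f → 𝑒 k *ˢ f) (𝑒 0) ks) (𝑒-monomials m ks)
    go []       = 𝑒-represents m 0
    go (k ∷ ks) = *ˢ-represents (𝑒 k) (foldr (λ k f → 𝑒 k *ˢ f) (𝑒 0) ks) {squarefree m k}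
      (𝑒-represents m k) (go ks)

  coloured-monomials : Graph → ∀ m → List (Vec ℕ m)
  coloured-monomials G m = map content (filter (proper? G) (words m (Graph.order G)))

  +length≡∑1 : ∀ {A : Set} (xs : List A) → ℤ.+ length xs ≡ ∑[ x ∈ xs ] 1ℤ
  +length≡∑1 []       = refl
  +length≡∑1 (x ∷ xs) = cong (λ n → 1ℤ ℤ.+ n) (+length≡∑1 xs)

  chromatic-represents : ∀ G m → Represents (chromatic G) (coloured-monomials G m)
  chromatic-represents G m α = begin
    ℤ.+ length (filter good? ws)                           ≡⟨ +length≡∑1 (filter good? ws) ⟩
    (∑[ κ ∈ filter good? ws ] 1ℤ)                        ≡⟨ ∑-filter good? (λ _ → 1ℤ) ws ⟩
    (∑[ κ ∈ ws ] (χ (good? κ) ℤ.* 1ℤ))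
      ≡⟨ ∑-cong (λ κ → trans (ℤ.*-identityʳ _) (χ-× (proper? G κ) (content κ ≟ᵛ α))) ws ⟩
    (∑[ κ ∈ ws ] (χ (proper? G κ) ℤ.* χ (content κ ≟ᵛ α)))
      ≡⟨ ∑-filter (proper? G) (λ κ → χ (content κ ≟ᵛ α)) ws ⟨
    (∑[ κ ∈ filter (proper? G) ws ] χ (content κ ≟ᵛ α))
      ≡⟨ ∑-map _ content (filter (proper? G) ws) ⟨
    mult (coloured-monomials G m) α ∎
    where
    ws = words m (Graph.order G)
    good? : (κ : Colouring G m) → Dec (Proper G κ × content κ ≡ α)
    good? κ = proper? G κ ×-dec (content κ ≟ᵛ α)

  0≤∑ : ∀ {X : Set} {f : X → ℤ} {xs} → All (λ x → 0ℤ ℤ.≤ f x) xs → 0ℤ ℤ.≤ ∑ xs f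
  0≤∑ []         = ℤ.≤-refl
  0≤∑ (px ∷ pxs) = ℤ.+-mono-≤ px (0≤∑ pxs)

  -- Both sides are regrouped over one finite set of exponent vectors containing every monomial that
  -- occurs in either. On it the multiplicities agree, because `expands` equates the coefficients.
  ∑-expansion : ∀ G m (E : 𝑒-Expansion (chromatic G)) (g : Vec ℕ m → ℤ) → let open 𝑒-Expansion E in
    ∑ (coloured-monomials G m) g ≡
      ∑[ μ ∈ support ] (coeff μ ℤ.* ∑ (𝑒-monomials m (Partition.parts μ)) g)
  ∑-expansion G m E g = begin
    ∑ L g                                                            ≡⟨ ∑-by-mult keys! L⊆keys g ⟩
    (∑[ α ∈ keys ] (mult L α ℤ.* g α))
      ≡⟨ ∑-cong (λ α → cong (ℤ._* g α) (mult-L α)) keys ⟩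
    (∑[ α ∈ keys ] ((∑[ μ ∈ support ] (coeff μ ℤ.* mult (M μ) α)) ℤ.* g α))
      ≡⟨ ∑-cong (λ α → ∑-*ʳ (g α) _ support) keys ⟨
    (∑[ α ∈ keys ] ∑[ μ ∈ support ] (coeff μ ℤ.* mult (M μ) α ℤ.* g α))
      ≡⟨ ∑-swap _ keys support ⟩
    (∑[ μ ∈ support ] ∑[ α ∈ keys ] (coeff μ ℤ.* mult (M μ) α ℤ.* g α))
      ≡⟨ ∑-cong (λ μ → trans (∑-cong (λ α → ℤ.*-assoc (coeff μ) (mult (M μ) α) (g α)) keys)
        (∑-*ˡ (coeff μ) _ keys)) support ⟩
    (∑[ μ ∈ support ] (coeff μ ℤ.* (∑[ α ∈ keys ] (mult (M μ) α ℤ.* g α))))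
      ≡⟨ ∑-cong-∈ {xs = support} (λ μ μ∈ → cong (coeff μ ℤ.*_) (∑-by-mult keys! (M⊆keys μ∈) g)) ⟨
    (∑[ μ ∈ support ] (coeff μ ℤ.* ∑ (M μ) g)) ∎
    where
    open 𝑒-Expansion E
    L = coloured-monomials G m
    M : Partition → List (Vec ℕ m)
    M μ = 𝑒-monomials m (Partition.parts μ)
    keys = deduplicate _≟ᵛ_ (L List.++ concatMap M support)
    keys! : Unique keys
    keys! = deduplicate-! _≟ᵛ_ (L List.++ concatMap M support)
    L⊆keys : ∀ {β} → β ∈ L → β ∈ keys
    L⊆keys β∈L = ∈-deduplicate⁺ _≟ᵛ_ (∈-++⁺ˡ β∈L)
    M⊆keys : ∀ {μ} → μ ∈ support → ∀ {β} → β ∈ M μ → β ∈ keys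
    M⊆keys μ∈ β∈ = ∈-deduplicate⁺ _≟ᵛ_ (∈-++⁺ʳ L (∈-concatMap⁺ M (Any.map (λ { refl → β∈ }) μ∈)))
    mult-L : ∀ α → mult L α ≡ ∑[ μ ∈ support ] (coeff μ ℤ.* mult (M μ) α)
    mult-L α = begin
      mult L α                                        ≡⟨ chromatic-represents G m α ⟨
      chromatic G m α                                 ≡⟨ expands m α ⟩
      (∑[ μ ∈ support ] (coeff μ ℤ.* 𝑒[ μ ] m α))
        ≡⟨ ∑-cong (λ μ → cong (coeff μ ℤ.*_) (𝑒[]-represents m μ α)) support ⟩
      (∑[ μ ∈ support ] (coeff μ ℤ.* mult (M μ) α))   ∎

  -- The dual form of 𝑒-positivity: a linear functional, given by its values g on monomials,
  -- certifies that G is not 𝑒-positive once it is non-negative on products of elementary symmetric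
  -- functions and negative on G.
  𝑒-positive⇒0≤∑ : ∀ G → 𝑒-PositiveGraph G → ∀ {m} (g : Vec ℕ m → ℤ) →
    (∀ ks → 0ℤ ℤ.≤ ∑ (𝑒-monomials m ks) g) → 0ℤ ℤ.≤ ∑ (coloured-monomials G m) g
  𝑒-positive⇒0≤∑ G (E , 0≤coeff) {m} g 0≤g = subst (0ℤ ℤ.≤_) (sym (∑-expansion G m E g))
    (0≤∑ (All.map (λ {μ} 0≤c → *-nonNeg 0≤c (0≤g (Partition.parts μ))) 0≤coeff))
    where
    *-nonNeg : ∀ {i j} → 0ℤ ℤ.≤ i → 0ℤ ℤ.≤ j → 0ℤ ℤ.≤ i ℤ.* j
    *-nonNeg {ℤ.+ i} {ℤ.+ j} _ _ = subst (0ℤ ℤ.≤_) (ℤ.pos-* i j) (ℤ.+≤+ z≤n)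

open Multiplicities

-- Weighted sums over proper colourings

module _ (G : Graph) where

  Avoids : Pred (Fin (order G)) 0ℓ → Fin m → Pred (Colouring G m) 0ℓ
  Avoids P i κ = ∀ v → P v → lookup κ v ≢ i

  avoids? : ∀ {P} → Decidable P → (i : Fin m) → Decidable (Avoids P i)
  avoids? P? i κ = Fin.all? λ v → P? v →-dec ¬? (lookup κ v Fin.≟ i)

  attach-proper : ∀ {P} (P? : Decidable P) (i : Fin m) κ →
    Proper (attach G P?) (i ∷ κ) ⇔ (Proper G κ × Avoids P i κ)
  attach-proper P? i κ = mk⇔
    (λ proper → (λ u v → proper (suc u) (suc v)) , λ v Pv eq → proper zero (suc v) Pv (sym eq))
    λ { (proper , avoids) → λ { zero    (suc v) Pv eq → avoids v Pv (sym eq)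
                              ; (suc u) zero    Pu eq → avoids u Pu eq
                              ; (suc u) (suc v)       → proper u v } }

module _ (G H : Graph) where

  ⊎ᴳ-proper : ∀ (κ : Colouring G m) (κ′ : Colouring H m) →
    Proper (G ⊎ᴳ H) (κ ++ κ′) ⇔ (Proper G κ × Proper H κ′)
  ⊎ᴳ-proper κ κ′ = mk⇔ (λ proper → to₁ proper , to₂ proper) from
    where
    to₁ : Proper (G ⊎ᴳ H) (κ ++ κ′) → Proper G κ
    to₁ proper u v u~v eq = proper (u ↑ˡ order H) (v ↑ˡ order H)
      (subst₂ (Pointwise (Graph._~_ G) (Graph._~_ H)) (sym (Fin.splitAt-↑ˡ (order G) u (order H)))
        (sym (Fin.splitAt-↑ˡ (order G) v (order H))) (inj₁ u~v))
      (trans (lookup-++ˡ κ κ′ u) (trans eq (sym (lookup-++ˡ κ κ′ v))))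
    to₂ : Proper (G ⊎ᴳ H) (κ ++ κ′) → Proper H κ′
    to₂ proper u v u~v eq = proper (order G ↑ʳ u) (order G ↑ʳ v)
      (subst₂ (Pointwise (Graph._~_ G) (Graph._~_ H)) (sym (Fin.splitAt-↑ʳ (order G) (order H) u))
        (sym (Fin.splitAt-↑ʳ (order G) (order H) v)) (inj₂ u~v))
      (trans (lookup-++ʳ κ κ′ u) (trans eq (sym (lookup-++ʳ κ κ′ v))))
    from : Proper G κ × Proper H κ′ → Proper (G ⊎ᴳ H) (κ ++ κ′)
    from (properᴳ , properᴴ) u v
      rewrite lookup-splitAt (order G) κ κ′ u | lookup-splitAt (order G) κ κ′ v
      with splitAt (order G) u | splitAt (order G) v
    ... | inj₁ u′ | inj₁ v′ = λ { (inj₁ u~v) → properᴳ u′ v′ u~v }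
    ... | inj₂ u′ | inj₂ v′ = λ { (inj₂ u~v) → properᴴ u′ v′ u~v }
    ... | inj₁ u′ | inj₂ v′ = λ ()
    ... | inj₂ u′ | inj₁ v′ = λ ()

  ⊎ᴳ-avoids : ∀ {P : Pred (Fin (order G)) 0ℓ} {Q : Pred (Fin (order H)) 0ℓ} (i : Fin m) κ κ′ →
    Avoids (G ⊎ᴳ H) ([ P , Q ] ∘ splitAt (order G)) i (κ ++ κ′) ⇔ (Avoids G P i κ × Avoids H Q i κ′)
  ⊎ᴳ-avoids {P = P} {Q} i κ κ′ = mk⇔
    (λ avoids →
        (λ v Pv eq → avoids (v ↑ˡ order H)
           (subst [ P , Q ] (sym (Fin.splitAt-↑ˡ (order G) v (order H))) Pv)
           (trans (lookup-++ˡ κ κ′ v) eq))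
      , (λ v Qv eq → avoids (order G ↑ʳ v)
           (subst [ P , Q ] (sym (Fin.splitAt-↑ʳ (order G) (order H) v)) Qv)
           (trans (lookup-++ʳ κ κ′ v) eq)))
    from
    where
    from : (Avoids G P i κ × Avoids H Q i κ′) →
      Avoids (G ⊎ᴳ H) ([ P , Q ] ∘ splitAt (order G)) i (κ ++ κ′)
    from (avoidsᴳ , avoidsᴴ) v rewrite lookup-splitAt (order G) κ κ′ v with splitAt (order G) v
    ... | inj₁ v′ = avoidsᴳ v′
    ... | inj₂ v′ = avoidsᴴ v′

-- Paths, peeled off from their first vertex

First : Pred (Fin n) 0ℓ
First v = toℕ v ≡ 0

first? : Decidable (First {n})
first? v = toℕ v ℕ.≟ 0

path-proper : ∀ (j : Fin m) (κ : Colouring (path n) m) →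
  Proper (path (suc n)) (j ∷ κ) ⇔ (Proper (path n) κ × Avoids (path n) First j κ)
path-proper j κ = mk⇔
  (λ proper → (λ u v → proper (suc u) (suc v) ∘ suc-adj)
            , (λ v v≡0 eq → proper zero (suc v) (inj₁ (cong suc (sym v≡0))) (sym eq)))
  from
  where
  suc-adj : ∀ {k l} → suc k ≡ l ⊎ suc l ≡ k → suc (suc k) ≡ suc l ⊎ suc (suc l) ≡ suc k
  suc-adj = [ inj₁ ∘ cong suc , inj₂ ∘ cong suc ]
  from : Proper (path _) κ × Avoids (path _) First j κ → Proper (path (suc _)) (j ∷ κ)
  from (proper , avoids) zero    zero    = λ { (inj₁ ()) ; (inj₂ ()) }
  from (proper , avoids) zero    (suc v) =
    λ { (inj₁ eq) j≡ → avoids v (sym (ℕ.suc-injective eq)) (sym j≡) ; (inj₂ ()) }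
  from (proper , avoids) (suc u) zero    =
    λ { (inj₂ eq) → avoids u (sym (ℕ.suc-injective eq)) ; (inj₁ ()) }
  from (proper , avoids) (suc u) (suc v) = proper u v ∘
    [ inj₁ ∘ ℕ.suc-injective , inj₂ ∘ ℕ.suc-injective ]

path-avoids : ∀ (i j : Fin m) (κ : Colouring (path n) m) →
  Avoids (path (suc n)) First i (j ∷ κ) ⇔ (j ≢ i)
path-avoids i j κ = mk⇔ (λ avoids → avoids zero refl) λ { j≢i zero _ → j≢i }

-- Contents of colourings

count-∷ : ∀ {A : Set} {P : Pred A 0ℓ} (P? : Decidable P) x (xs : Vec A n) →
  count P? (x ∷ xs) ≡ count P? (x ∷ []) + count P? xs
count-∷ P? x xs with does (P? x)
... | true  = refl
... | false = refl

zipWith-tabulate : ∀ (f : ℕ → ℕ → ℕ) (g h : Fin m → ℕ) →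
  zipWith f (tabulate g) (tabulate h) ≡ tabulate λ j → f (g j) (h j)
zipWith-tabulate {zero}  f g h = refl
zipWith-tabulate {suc m} f g h = cong (f (g zero) (h zero) ∷_)
  (zipWith-tabulate f (g ∘ suc) (h ∘ suc))

content-∷ : ∀ (i : Fin m) (κ : Vec (Fin m) n) →
  content (i ∷ κ) ≡ zipWith _+_ (content (i ∷ [])) (content κ)
content-∷ i κ = trans (tabulate-cong λ j → count-∷ (Fin._≟ j) i κ) (sym (zipWith-tabulate _+_ _ _))

module Weights {A : Set} {_+ᴬ_ _*_ : Op₂ A} { -_ : Op₁ A} {0# 1# : A}
               (isCommutativeRing : IsCommutativeRing _≡_ _+ᴬ_ _*_ -_ 0# 1#) where

  private
    module R = IsCommutativeRing isCommutativeRing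
    commutativeRing : CommutativeRing 0ℓ 0ℓ
    commutativeRing = record { isCommutativeRing = isCommutativeRing }

  open Sum isCommutativeRing
  open import Algebra.Properties.Semiring.Exp (CommutativeRing.semiring commutativeRing)
    using (^-homo-*) renaming (_^_ to _^ᴬ_)
  open import Algebra.Properties.CommutativeSemigroup
    (CommutativeRing.*-commutativeSemigroup commutativeRing)
    using (interchange; x∙yz≈y∙xz)
  open import Algebra.Properties.Group (CommutativeRing.+-group commutativeRing)
    using () renaming (∙-cancelʳ to +-cancelʳ) public
  open import Algebra.Solver.Ring.NaturalCoefficients.Default
    (CommutativeRing.commutativeSemiring commutativeRing)
    using (solve; con; _:+_; _:*_; _:=_)

  monomial : Vec A m → Vec ℕ m → A
  monomial []       []      = 1#
  monomial (x ∷ xs) (a ∷ α) = (x ^ᴬ a) * monomial xs α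

  monomial-+ : ∀ (xs : Vec A m) α β → monomial xs (zipWith _+_ α β) ≡ monomial xs α * monomial xs β
  monomial-+ []       []      []      = sym (R.*-identityˡ 1#)
  monomial-+ (x ∷ xs) (a ∷ α) (b ∷ β) =
    trans (cong₂ _*_ (^-homo-* x a b) (monomial-+ xs α β)) (interchange _ _ _ _)

  monomial-0 : ∀ (xs : Vec A m) → monomial xs (tabulate λ _ → 0) ≡ 1#
  monomial-0 []       = refl
  monomial-0 (x ∷ xs) = trans (R.*-identityˡ _) (monomial-0 xs)

  monomial-content : ∀ (xs : Vec A m) i → monomial xs (content (i ∷ [])) ≡ lookup xs i
  monomial-content (x ∷ xs) zero    = trans (cong₂ _*_ (R.*-identityʳ x) (monomial-0 xs))
    (R.*-identityʳ x)
  monomial-content (x ∷ xs) (suc i) = trans (R.*-identityˡ _) (monomial-content xs i)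

  module _ (xs : Vec A m) where

    weight : Vec (Fin m) n → A
    weight []      = 1#
    weight (i ∷ κ) = lookup xs i * weight κ

    weight-++ : ∀ (κ : Vec (Fin m) k) (κ′ : Vec (Fin m) l) → weight (κ ++ κ′) ≡ weight κ * weight κ′
    weight-++ []      κ′ = sym (R.*-identityˡ _)
    weight-++ (i ∷ κ) κ′ = trans (cong (lookup xs i *_) (weight-++ κ κ′)) (sym (R.*-assoc _ _ _))

    monomial-content≡weight : ∀ (κ : Vec (Fin m) n) → monomial xs (content κ) ≡ weight κ
    monomial-content≡weight []      = monomial-0 xs
    monomial-content≡weight (i ∷ κ) = begin
      monomial xs (content (i ∷ κ))
        ≡⟨ cong (monomial xs) (content-∷ i κ) ⟩
      monomial xs (zipWith _+_ (content (i ∷ [])) (content κ))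
        ≡⟨ monomial-+ xs (content (i ∷ [])) (content κ) ⟩
      monomial xs (content (i ∷ [])) * monomial xs (content κ)
        ≡⟨ cong₂ _*_ (monomial-content xs i) (monomial-content≡weight κ) ⟩
      lookup xs i * weight κ                                     ∎

    ∑-words-∷ : ∀ n (F : Vec (Fin m) (suc n) → A) →
      ∑ (words m (suc n)) F ≡ ∑[ i ∈ allFin m ] ∑[ κ ∈ words m n ] F (i ∷ κ)
    ∑-words-∷ n F = trans (∑-concatMap F (λ i → map (i ∷_) (words m n)) (allFin m))
      (∑-cong (λ i → ∑-map F (i ∷_) (words m n)) (allFin m))

    ∑-words-++ : ∀ p q (F : Vec (Fin m) (p + q) → A) →
      ∑ (words m (p + q)) F ≡ ∑[ κ ∈ words m p ] ∑[ κ′ ∈ words m q ] F (κ ++ κ′)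
    ∑-words-++ zero    q F = sym (R.+-identityʳ _)
    ∑-words-++ (suc p) q F = begin
      ∑ (words m (suc p + q)) F
        ≡⟨ ∑-words-∷ (p + q) F ⟩
      (∑[ i ∈ allFin m ] ∑[ κ ∈ words m (p + q) ] F (i ∷ κ))
        ≡⟨ ∑-cong (λ i → ∑-words-++ p q (F ∘ (i ∷_))) (allFin m) ⟩
      (∑[ i ∈ allFin m ] ∑[ κ ∈ words m p ] ∑[ κ′ ∈ words m q ] F (i ∷ κ ++ κ′))
        ≡⟨ ∑-words-∷ p _ ⟨
      (∑[ κ ∈ words m (suc p) ] ∑[ κ′ ∈ words m q ] F (κ ++ κ′)) ∎

    ∑-proper : Graph → A
    ∑-proper G = ∑[ κ ∈ words m (order G) ] (χ (proper? G κ) * weight κ)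

    -- P stands for the neighbours of a vertex of colour i outside G. With that colour fixed, the
    -- components of G no longer interact, so these sums multiply over disjoint unions.
    ∑-avoiding : (G : Graph) {P : Pred (Fin (order G)) 0ℓ} → Decidable P → Fin m → A
    ∑-avoiding G P? i = ∑[ κ ∈ words m (order G) ] (χ (proper? G κ ×-dec avoids? G P? i κ) * weight κ)

    ∑-attach : ∀ G {P} (P? : Decidable P) →
      ∑-proper (attach G P?) ≡ ∑[ i ∈ allFin m ] (lookup xs i * ∑-avoiding G P? i)
    ∑-attach G P? = trans (∑-words-∷ (order G) _) (∑-cong (λ i → trans
      (∑-cong (λ κ → trans
        (cong (_* (lookup xs i * weight κ))
          (χ-⇔ (attach-proper G P? i κ) (proper? (attach G P?) (i ∷ κ))
            (proper? G κ ×-dec avoids? G P? i κ)))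
        (x∙yz≈y∙xz _ _ _)) (words m (order G)))
      (∑-*ˡ (lookup xs i) _ (words m (order G)))) (allFin m))

    -- The decision procedure `PQ?` is arbitrary because `foot?` is not literally assembled from
    -- `first?` and a shorter `foot?`; `χ` depends only on the truth of the predicate.
    ∑-⊎ᴳ : ∀ G H {P Q} (P? : Decidable P) (Q? : Decidable Q)
      (PQ? : Decidable ([ P , Q ] ∘ splitAt (order G))) i →
      ∑-avoiding (G ⊎ᴳ H) PQ? i ≡ ∑-avoiding G P? i * ∑-avoiding H Q? i
    ∑-⊎ᴳ G H {P} {Q} P? Q? PQ? i = begin
      ∑-avoiding (G ⊎ᴳ H) PQ? i
        ≡⟨ ∑-words-++ (order G) (order H) _ ⟩
      (∑[ κ ∈ words m (order G) ] ∑[ κ′ ∈ words m (order H) ] (χ (good? κ κ′) * weight (κ ++ κ′)))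
        ≡⟨ ∑-cong (λ κ → ∑-cong (λ κ′ → split κ κ′) (words m (order H))) (words m (order G)) ⟩
      (∑[ κ ∈ words m (order G) ] ∑[ κ′ ∈ words m (order H) ]
        ((χ (goodᴳ? κ) * weight κ) * (χ (goodᴴ? κ′) * weight κ′)))
        ≡⟨ ∑-*-∑ _ _ (words m (order G)) (words m (order H)) ⟨
      ∑-avoiding G P? i * ∑-avoiding H Q? i ∎
      where
      goodᴳ? : (κ : Colouring G m) → Dec (Proper G κ × Avoids G P i κ)
      goodᴳ? κ = proper? G κ ×-dec avoids? G P? i κ
      goodᴴ? : (κ : Colouring H m) → Dec (Proper H κ × Avoids H Q i κ)
      goodᴴ? κ = proper? H κ ×-dec avoids? H Q? i κ
      good? : ∀ κ κ′ → Dec (Proper (G ⊎ᴳ H) (κ ++ κ′) ×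
        Avoids (G ⊎ᴳ H) ([ P , Q ] ∘ splitAt (order G)) i (κ ++ κ′))
      good? κ κ′ = proper? (G ⊎ᴳ H) (κ ++ κ′) ×-dec avoids? (G ⊎ᴳ H) PQ? i (κ ++ κ′)
      good-⇔ : ∀ κ κ′ → (Proper (G ⊎ᴳ H) (κ ++ κ′) ×
        Avoids (G ⊎ᴳ H) ([ P , Q ] ∘ splitAt (order G)) i (κ ++ κ′)) ⇔
        ((Proper G κ × Avoids G P i κ) × (Proper H κ′ × Avoids H Q i κ′))
      good-⇔ κ κ′ = mk⇔
        (λ (proper , avoids) →
          let pᴳ , pᴴ = to (⊎ᴳ-proper G H κ κ′) proper
              aᴳ , aᴴ = to (⊎ᴳ-avoids G H {P = P} {Q} i κ κ′) avoids
          in (pᴳ , aᴳ) , (pᴴ , aᴴ))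
        (λ ((pᴳ , aᴳ) , (pᴴ , aᴴ)) → from (⊎ᴳ-proper G H κ κ′)
          (pᴳ , pᴴ) , from (⊎ᴳ-avoids G H {P = P} {Q} i κ κ′) (aᴳ , aᴴ))
        where open Equivalence
      split : ∀ κ κ′ → χ (good? κ κ′) * weight (κ ++ κ′) ≡
        (χ (goodᴳ? κ) * weight κ) * (χ (goodᴴ? κ′) * weight κ′)
      split κ κ′ = trans (cong₂ _*_
        (trans (χ-⇔ (good-⇔ κ κ′) (good? κ κ′) (goodᴳ? κ ×-dec goodᴴ? κ′))
          (χ-× (goodᴳ? κ) (goodᴴ? κ′))) (weight-++ κ κ′))
        (interchange _ _ _ _)

    -- Sums over the colourings of a leg of length l compatible with colour i at the centre.
    leg : ℕ → Fin m → A
    leg l = ∑-avoiding (path l) first?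

    leg-0 : ∀ i → leg 0 i ≡ 1#
    leg-0 i = trans (R.+-identityʳ _) (R.*-identityˡ 1#)

    leg-suc : ∀ l i → leg (suc l) i ≡ ∑[ j ∈ allFin m ] (χ (¬? (j Fin.≟ i)) * (lookup xs j * leg l j))
    leg-suc l i = trans (∑-words-∷ l _) (∑-cong (λ j → begin
      (∑[ κ ∈ words m l ] (χ (good? j κ) * weight (j ∷ κ)))
        ≡⟨ ∑-cong (λ κ → split j κ) (words m l) ⟩
      (∑[ κ ∈ words m l ] ((χ (¬? (j Fin.≟ i)) * lookup xs j) * (χ (goodʲ? j κ) * weight κ)))
        ≡⟨ ∑-*ˡ _ _ (words m l) ⟩
      (χ (¬? (j Fin.≟ i)) * lookup xs j) * leg l j
        ≡⟨ R.*-assoc _ _ _ ⟩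
      χ (¬? (j Fin.≟ i)) * (lookup xs j * leg l j) ∎) (allFin m))
      where
      good? : ∀ j κ → Dec (Proper (path (suc l)) (j ∷ κ) × Avoids (path (suc l)) First i (j ∷ κ))
      good? j κ = proper? (path (suc l)) (j ∷ κ) ×-dec avoids? (path (suc l)) first? i (j ∷ κ)
      goodʲ? : ∀ j κ → Dec (Proper (path l) κ × Avoids (path l) First j κ)
      goodʲ? j κ = proper? (path l) κ ×-dec avoids? (path l) first? j κ
      good-⇔ : ∀ j κ → (Proper (path (suc l)) (j ∷ κ) × Avoids (path (suc l)) First i (j ∷ κ)) ⇔
        (j ≢ i × (Proper (path l) κ × Avoids (path l) First j κ))
      good-⇔ j κ = mk⇔
        (λ (proper , avoids) → to (path-avoids i j κ) avoids , to (path-proper j κ) proper)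
        (λ (j≢i , good) → from (path-proper j κ) good , from (path-avoids i j κ) j≢i)
        where open Equivalence
      split : ∀ j κ → χ (good? j κ) * weight (j ∷ κ) ≡
        (χ (¬? (j Fin.≟ i)) * lookup xs j) * (χ (goodʲ? j κ) * weight κ)
      split j κ = trans (cong (_* weight (j ∷ κ))
        (trans (χ-⇔ (good-⇔ j κ) (good? j κ) (¬? (j Fin.≟ i) ×-dec goodʲ? j κ))
          (χ-× (¬? (j Fin.≟ i)) (goodʲ? j κ))))
        (interchange _ _ _ _)

    ∑-χ-≢ : ∀ i (f : Fin m → A) → (∑[ j ∈ allFin m ] (χ (¬? (j Fin.≟ i)) * f j)) +ᴬ f i ≡
      ∑ (allFin m) f
    ∑-χ-≢ i f = begin
      (∑[ j ∈ allFin m ] (χ (¬? (j Fin.≟ i)) * f j)) +ᴬ f i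
        ≡⟨ cong ((∑[ j ∈ allFin m ] (χ (¬? (j Fin.≟ i)) * f j)) +ᴬ_)
          (∑-δ Fin._≟_ f (allFin⁺ m) (∈-allFin i)) ⟨
      (∑[ j ∈ allFin m ] (χ (¬? (j Fin.≟ i)) * f j)) +ᴬ (∑[ j ∈ allFin m ] (χ (i Fin.≟ j) * f j))
        ≡⟨ ∑-+ _ _ (allFin m) ⟨
      (∑[ j ∈ allFin m ] ((χ (¬? (j Fin.≟ i)) * f j) +ᴬ (χ (i Fin.≟ j) * f j)))
        ≡⟨ ∑-cong (λ j → trans (sym (R.distribʳ (f j) _ _))
          (trans (cong (_* f j) (one j)) (R.*-identityˡ (f j)))) (allFin m) ⟩
      ∑ (allFin m) f ∎
      where
      one : ∀ j → χ (¬? (j Fin.≟ i)) +ᴬ χ (i Fin.≟ j) ≡ 1#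
      one j with j Fin.≟ i
      ... | yes j≡i = trans (cong (0# +ᴬ_) (χ-true (i Fin.≟ j) (sym j≡i))) (R.+-identityˡ 1#)
      ... | no  j≢i = trans (cong (1# +ᴬ_) (χ-false (i Fin.≟ j) (j≢i ∘ sym))) (R.+-identityʳ 1#)

    pathSum : ℕ → A
    pathSum zero    = 1#
    pathSum (suc l) = ∑[ i ∈ allFin m ] (lookup xs i * leg l i)

    -- The second summand restores the colourings whose first vertex has the forbidden colour i, and
    -- the constraint from the centre disappears.
    leg-suc-+ : ∀ l i → leg (suc l) i +ᴬ (lookup xs i * leg l i) ≡ pathSum (suc l)
    leg-suc-+ l i = trans (cong (_+ᴬ (lookup xs i * leg l i)) (leg-suc l i)) (∑-χ-≢ i _)

    legProduct : List ℕ → Fin m → A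
    legProduct []       i = 1#
    legProduct (l ∷ ls) i = leg l i * legProduct ls i

    ∑-legs : ∀ ls i → ∑-avoiding (legs ls) (foot? ls) i ≡ legProduct ls i
    ∑-legs []       i = trans (R.+-identityʳ _) (R.*-identityˡ 1#)
    ∑-legs (l ∷ ls) i = trans (∑-⊎ᴳ (path l) (legs ls) first? (foot? ls) (foot? (l ∷ ls)) i)
      (cong (leg l i *_) (∑-legs ls i))

    ∑-spider : ∀ ls → ∑-proper (spider ls) ≡ ∑[ i ∈ allFin m ] (lookup xs i * legProduct ls i)
    ∑-spider ls = trans (∑-attach (legs ls) (foot? ls))
      (∑-cong (λ i → cong (lookup xs i *_) (∑-legs ls i)) (allFin m))

    leg-suc-* : ∀ l i (y : A) → (leg (suc l) i * y) +ᴬ (lookup xs i * (leg l i * y)) ≡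
      pathSum (suc l) * y
    leg-suc-* l i y = trans (cong ((leg (suc l) i * y) +ᴬ_) (sym (R.*-assoc _ _ _)))
      (trans (sym (R.distribʳ y _ _)) (cong (_* y) (leg-suc-+ l i)))

    ∑ʷ : (Fin m → A) → A
    ∑ʷ f = ∑[ i ∈ allFin m ] (lookup xs i * f i)

    -- Summing `leg-suc-+` over i shows that the legs of length 1 + b add up to (m - 1) times
    -- `pathSum (suc b)`. Both sides are thus m - 1 copies of one product; adding one more copy
    -- avoids the subtraction.
    pathSum-swap : ∀ a b → pathSum (suc a) * ∑ (allFin m) (leg (suc b)) ≡
      pathSum (suc b) * ∑ (allFin m) (leg (suc a))
    pathSum-swap a b = +-cancelʳ (pathSum (suc a) * pathSum (suc b)) _ _ (begin
      (P * ∑ (allFin m) (leg (suc b))) +ᴬ (P * Q)   ≡⟨ eq P b ⟩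
      ∑[ i ∈ allFin m ] (P * Q)                     ≡⟨ ∑-cong (λ _ → R.*-comm P Q) (allFin m) ⟩
      ∑[ i ∈ allFin m ] (Q * P)                     ≡⟨ eq Q a ⟨
      (Q * ∑ (allFin m) (leg (suc a))) +ᴬ (Q * P)
        ≡⟨ cong ((Q * ∑ (allFin m) (leg (suc a))) +ᴬ_) (R.*-comm Q P) ⟩
      (Q * ∑ (allFin m) (leg (suc a))) +ᴬ (P * Q)   ∎)
      where
      P = pathSum (suc a)
      Q = pathSum (suc b)
      eq : ∀ c l → (c * ∑ (allFin m) (leg (suc l))) +ᴬ (c * pathSum (suc l)) ≡
        ∑[ i ∈ allFin m ] (c * pathSum (suc l))
      eq c l = begin
        (c * ∑ (allFin m) (leg (suc l))) +ᴬ (c * pathSum (suc l))   ≡⟨ R.distribˡ c _ _ ⟨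
        c * (∑ (allFin m) (leg (suc l)) +ᴬ pathSum (suc l))
          ≡⟨ cong (c *_) (∑-+ _ _ (allFin m)) ⟨
        c * (∑[ i ∈ allFin m ] (leg (suc l) i +ᴬ (lookup xs i * leg l i)))
          ≡⟨ cong (c *_) (∑-cong (leg-suc-+ l) (allFin m)) ⟩
        c * (∑[ i ∈ allFin m ] pathSum (suc l))                     ≡⟨ ∑-*ˡ c _ (allFin m) ⟨
        (∑[ i ∈ allFin m ] (c * pathSum (suc l)))                   ∎

    -- Two legs meeting at a centre form a path. No graph isomorphism is needed: vertices move one
    -- at a time from the first leg to the second until the first is empty. Such a move preserves
    -- the sum because adding S to either side gives the two products of `pathSum-swap`.
    pathSum-glue : ∀ a b → ∑ʷ (λ i → leg a i * leg b i) ≡ pathSum (suc (a + b))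
    pathSum-glue zero    b = ∑-cong
      (λ i → cong (lookup xs i *_) (trans (cong (_* leg b i) (leg-0 i)) (R.*-identityˡ _))) (allFin m)
    pathSum-glue (suc a) b = begin
      ∑ʷ (λ i → leg (suc a) i * leg b i)   ≡⟨ +-cancelʳ S _ _ shift ⟩
      ∑ʷ (λ i → leg a i * leg (suc b) i)   ≡⟨ pathSum-glue a (suc b) ⟩
      pathSum (suc (a + suc b))            ≡⟨ cong (pathSum ∘ suc) (ℕ.+-suc a b) ⟩
      pathSum (suc (suc a + b))            ∎
      where
      S = ∑[ i ∈ allFin m ] (leg (suc a) i * leg (suc b) i)
      half : ∀ k l → ∑ʷ (λ i → leg k i * leg l i) +ᴬ (∑[ i ∈ allFin m ] (leg (suc k) i * leg l i))
        ≡ pathSum (suc k) * ∑ (allFin m) (leg l)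
      half k l = begin
        ∑ʷ (λ i → leg k i * leg l i) +ᴬ (∑[ i ∈ allFin m ] (leg (suc k) i * leg l i))
          ≡⟨ R.+-comm _ _ ⟩
        (∑[ i ∈ allFin m ] (leg (suc k) i * leg l i)) +ᴬ ∑ʷ (λ i → leg k i * leg l i)
          ≡⟨ ∑-+ _ _ (allFin m) ⟨
        (∑[ i ∈ allFin m ] ((leg (suc k) i * leg l i) +ᴬ (lookup xs i * (leg k i * leg l i))))
          ≡⟨ ∑-cong (λ i → leg-suc-* k i (leg l i)) (allFin m) ⟩
        (∑[ i ∈ allFin m ] (pathSum (suc k) * leg l i))
          ≡⟨ ∑-*ˡ _ _ (allFin m) ⟩
        pathSum (suc k) * ∑ (allFin m) (leg l) ∎
      shift : ∑ʷ (λ i → leg (suc a) i * leg b i) +ᴬ S ≡ ∑ʷ (λ i → leg a i * leg (suc b) i) +ᴬ S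
      shift = begin
        ∑ʷ (λ i → leg (suc a) i * leg b i) +ᴬ S
          ≡⟨ cong₂ _+ᴬ_ (∑-cong (λ i → cong (lookup xs i *_) (R.*-comm _ _)) (allFin m))
            (∑-cong (λ i → R.*-comm _ _) (allFin m)) ⟩
        ∑ʷ (λ i → leg b i * leg (suc a) i) +ᴬ (∑[ i ∈ allFin m ] (leg (suc b) i * leg (suc a) i))
          ≡⟨ half b (suc a) ⟩
        pathSum (suc b) * ∑ (allFin m) (leg (suc a))
          ≡⟨ pathSum-swap a b ⟨
        pathSum (suc a) * ∑ (allFin m) (leg (suc b))
          ≡⟨ half a (suc b) ⟨
        ∑ʷ (λ i → leg a i * leg (suc b) i) +ᴬ S ∎

    -- The formula for S(a,b,2), with the negative terms moved to the left.
    ∑-spider₂ : ∀ a b →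
      ∑-proper (spider (a ∷ b ∷ 2 ∷ [])) +ᴬ
        ((pathSum (1 + a) * pathSum (2 + b)) +ᴬ (pathSum (1 + b) * pathSum (2 + a))) ≡
      (pathSum 2 * pathSum (1 + (a + b))) +ᴬ
        ((pathSum 1 * pathSum (2 + (a + b))) +ᴬ pathSum (3 + (a + b)))
    -- The product of P₁, P and Q is added to both sides. On the left its factor Q is opened into a
    -- sum over the colour of the centre, on the right its factor P₁; the two sides can then be
    -- compared colour by colour.
    ∑-spider₂ a b = +-cancelʳ (P₁ * (P * Q)) _ _ (begin
      (∑-proper (spider (a ∷ b ∷ 2 ∷ [])) +ᴬ ((P * pathSum (2 + b)) +ᴬ (Q * pathSum (2 + a)))) +ᴬ
        (P₁ * (P * Q))
        ≡⟨ solve 4 (λ x y z w → (x :+ (y :+ z)) :+ w := x :+ (y :+ (z :+ w))) refl _ _ _ _ ⟩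
      ∑-proper (spider (a ∷ b ∷ 2 ∷ [])) +ᴬ
        ((P * pathSum (2 + b)) +ᴬ ((Q * pathSum (2 + a)) +ᴬ (P₁ * (P * Q))))
        ≡⟨ cong₂ _+ᴬ_ (∑-spider (a ∷ b ∷ 2 ∷ []))
          (cong₂ _+ᴬ_ (sym (out P (leg (1 + b)))) (cong₂ _+ᴬ_ (sym (out Q (leg (1 + a))))
             (trans (cong (P₁ *_) (sym (out P (leg b)))) (sym (∑-*ˡ P₁ _ (allFin m)))))) ⟩
      ∑ (allFin m) f₁ +ᴬ (∑ (allFin m) f₂ +ᴬ (∑ (allFin m) f₃ +ᴬ ∑ (allFin m) f₄))
        ≡⟨ ∑-+₄ f₁ f₂ f₃ f₄ ⟨
      (∑[ i ∈ allFin m ] (f₁ i +ᴬ (f₂ i +ᴬ (f₃ i +ᴬ f₄ i))))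
        ≡⟨ ∑-cong pointwise (allFin m) ⟩
      (∑[ i ∈ allFin m ] (g₁ i +ᴬ (g₂ i +ᴬ (g₃ i +ᴬ g₄ i))))
        ≡⟨ ∑-+₄ g₁ g₂ g₃ g₄ ⟩
      ∑ (allFin m) g₁ +ᴬ (∑ (allFin m) g₂ +ᴬ (∑ (allFin m) g₃ +ᴬ ∑ (allFin m) g₄))
        ≡⟨ cong₂ _+ᴬ_ (trans (out P₂ _) (cong (P₂ *_) (pathSum-glue a b)))
          (cong₂ _+ᴬ_ (trans (out P₁ _) (cong (P₁ *_) (pathSum-glue (suc a) b)))
             (cong₂ _+ᴬ_ (out (P * Q) (leg 0))
               (trans (pathSum-glue (suc a) (suc b)) (cong (λ n → pathSum (2 + n)) (ℕ.+-suc a b))))) ⟩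
      (P₂ * pathSum (1 + (a + b))) +ᴬ
        ((P₁ * pathSum (2 + (a + b))) +ᴬ (((P * Q) * P₁) +ᴬ pathSum (3 + (a + b))))
        ≡⟨ solve 5 (λ x y p q z → x :+ (y :+ ((p :* q) :+ z)) := (x :+ (y :+ z)) :+ (q :* p)) refl
          _ _ _ _ _ ⟩
      ((P₂ * pathSum (1 + (a + b))) +ᴬ ((P₁ * pathSum (2 + (a + b))) +ᴬ pathSum (3 + (a + b)))) +ᴬ
        (P₁ * (P * Q)) ∎)
      where
      P₁ = pathSum 1
      P₂ = pathSum 2
      P = pathSum (1 + a)
      Q = pathSum (1 + b)
      x : Fin m → A
      x = lookup xs
      f₁ f₂ f₃ f₄ g₁ g₂ g₃ g₄ : Fin m → A
      f₁ i = x i * legProduct (a ∷ b ∷ 2 ∷ []) i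
      f₂ i = P * (x i * leg (1 + b) i)
      f₃ i = Q * (x i * leg (1 + a) i)
      f₄ i = P₁ * (P * (x i * leg b i))
      g₁ i = P₂ * (x i * (leg a i * leg b i))
      g₂ i = P₁ * (x i * (leg (1 + a) i * leg b i))
      g₃ i = (P * Q) * (x i * leg 0 i)
      g₄ i = x i * (leg (1 + a) i * leg (1 + b) i)
      out : ∀ c (f : Fin m → A) → ∑[ i ∈ allFin m ] (c * (x i * f i)) ≡ c * ∑ʷ f
      out c f = ∑-*ˡ c _ (allFin m)
      ∑-+₄ : ∀ (f₁ f₂ f₃ f₄ : Fin m → A) → ∑[ i ∈ allFin m ] (f₁ i +ᴬ (f₂ i +ᴬ (f₃ i +ᴬ f₄ i))) ≡
        ∑ (allFin m) f₁ +ᴬ (∑ (allFin m) f₂ +ᴬ (∑ (allFin m) f₃ +ᴬ ∑ (allFin m) f₄))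
      ∑-+₄ f₁ f₂ f₃ f₄ = trans (∑-+ f₁ _ (allFin m)) (cong (∑ (allFin m) f₁ +ᴬ_)
        (trans (∑-+ f₂ _ (allFin m)) (cong (∑ (allFin m) f₂ +ᴬ_) (∑-+ f₃ f₄ (allFin m)))))
      -- The leg of length 2 is P₂ - xP₁ + x². The resulting x²AB is removed through xA = P - A′ and
      -- xB = Q - B′, so that no term keeps a product of more than two legs and `pathSum-glue`
      -- applies.
      pointwise : ∀ i → f₁ i +ᴬ (f₂ i +ᴬ (f₃ i +ᴬ f₄ i)) ≡ g₁ i +ᴬ (g₂ i +ᴬ (g₃ i +ᴬ g₄ i))
      pointwise i = identity (leg-suc-+ a i) (leg-suc-+ b i) (leg-suc-+ 1 i)
        (trans (cong (λ l → leg 1 i +ᴬ (x i * l)) (sym (leg-0 i))) (leg-suc-+ 0 i)) (leg-0 i)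
        where
        identity : ∀ {x A B A′ B′ L₀ L₁ L₂ P Q P₂ P₁} → A′ +ᴬ (x * A) ≡ P →
          B′ +ᴬ (x * B) ≡ Q → L₂ +ᴬ (x * L₁) ≡ P₂ → L₁ +ᴬ (x * 1#) ≡ P₁ → L₀ ≡ 1# →
          (x * (A * (B * (L₂ * 1#)))) +ᴬ
            ((P * (x * B′)) +ᴬ ((Q * (x * A′)) +ᴬ (P₁ * (P * (x * B))))) ≡
          (P₂ * (x * (A * B))) +ᴬ ((P₁ * (x * (A′ * B))) +ᴬ (((P * Q) * (x * L₀)) +ᴬ (x * (A′ * B′))))
        identity {x} {A} {B} {A′} {B′} {_} {L₁} {L₂} refl refl refl refl refl = solve 7
          (λ x A B A′ B′ L₁ L₂ →
          let P = A′ :+ x :* A ; Q = B′ :+ x :* B ; P₂ = L₂ :+ x :* L₁ ; P₁ = L₁ :+ x :* con 1 in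
          x :* (A :* (B :* (L₂ :* con 1))) :+
            (P :* (x :* B′) :+ (Q :* (x :* A′) :+ P₁ :* (P :* (x :* B)))) :=
          P₂ :* (x :* (A :* B)) :+
            (P₁ :* (x :* (A′ :* B)) :+ ((P :* Q) :* (x :* con 1) :+ x :* (A′ :* B′)))) refl x A B
              A′ B′ L₁ L₂

-- Specialisations

open Eisenstein using (ℤ[ω]; _+_ω; 𝟎; 𝟏)
open Truncated using (ℤ[ω,ε]; ⟨_,_,_⟩; ext; _⊕_; _⊗_; ⊝_)
open Weights Truncated.isCommutativeRing
open Sum Truncated.isCommutativeRing

-- All values that matter lie in this semiring. Its closure under products is the source of
-- non-negativity, and it leaves the final comparisons as inequalities between natural numbers.
data ℕ[ε] : Set where
  ⟪_,_,_⟫ : ℕ → ℕ → ℕ → ℕ[ε]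

infixl 6 _+ᵗ_
infixl 7 _*ᵗ_
_+ᵗ_ _*ᵗ_ : ℕ[ε] → ℕ[ε] → ℕ[ε]
⟪ a , b , c ⟫ +ᵗ ⟪ d , e , f ⟫ = ⟪ a + d , b + e , c + f ⟫
⟪ a , b , c ⟫ *ᵗ ⟪ d , e , f ⟫ = ⟪ a * d , a * e + b * d , a * f + b * e + c * d ⟫

coefficient : Fin 3 → ℕ[ε] → ℕ
coefficient 0F ⟪ a , b , c ⟫ = a
coefficient 1F ⟪ a , b , c ⟫ = b
coefficient 2F ⟪ a , b , c ⟫ = c

⌜_⌝ : ℕ → ℤ[ω]
⌜ n ⌝ = (ℤ.+ n) + 0ℤ ω

⌜⌝-* : ∀ m n → ⌜ m * n ⌝ ≡ ⌜ m ⌝ Eisenstein.⊗ ⌜ n ⌝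
⌜⌝-* m n = cong₂ _+_ω (trans (ℤ.pos-* m n) (sym (ℤ.+-identityʳ _)))
  (sym (trans (ℤ.+-identityʳ _) (trans (ℤ.+-identityʳ _) (ℤ.*-zeroʳ (ℤ.+ m)))))

ι : ℕ[ε] → ℤ[ω,ε]
ι ⟪ a , b , c ⟫ = ⟨ ⌜ a ⌝ , ⌜ b ⌝ , ⌜ c ⌝ ⟩

ι-+ : ∀ s t → ι (s +ᵗ t) ≡ ι s ⊕ ι t
ι-+ ⟪ _ , _ , _ ⟫ ⟪ _ , _ , _ ⟫ = refl

ι-* : ∀ s t → ι (s *ᵗ t) ≡ ι s ⊗ ι t
ι-* ⟪ a , b , c ⟫ ⟪ d , e , f ⟫ = ext (⌜⌝-* a d)
  (cong₂ Eisenstein._⊕_ (⌜⌝-* a e) (⌜⌝-* b d))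
  (cong₂ Eisenstein._⊕_ (cong₂ Eisenstein._⊕_ (⌜⌝-* a f) (⌜⌝-* b e)) (⌜⌝-* c d))

re : ℤ[ω] → ℤ
re (a + b ω) = a

-- Single monomials have values with a nonzero ω-part, so an additive projection from the whole ring
-- is required; on the image of `ι` it recovers the coefficient.
π : Fin 3 → ℤ[ω,ε] → ℤ
π 0F ⟨ a , b , c ⟩ = re a
π 1F ⟨ a , b , c ⟩ = re b
π 2F ⟨ a , b , c ⟩ = re c

re-+ : ∀ x y → re (x Eisenstein.⊕ y) ≡ re x ℤ.+ re y
re-+ (_ + _ ω) (_ + _ ω) = refl

π-+ : ∀ j r s → π j (r ⊕ s) ≡ π j r ℤ.+ π j s
π-+ 0F ⟨ a , b , c ⟩ ⟨ d , e , f ⟩ = re-+ a d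
π-+ 1F ⟨ a , b , c ⟩ ⟨ d , e , f ⟩ = re-+ b e
π-+ 2F ⟨ a , b , c ⟩ ⟨ d , e , f ⟩ = re-+ c f

π-ι : ∀ j t → π j (ι t) ≡ ℤ.+ coefficient j t
π-ι 0F ⟪ a , b , c ⟫ = refl
π-ι 1F ⟪ a , b , c ⟫ = refl
π-ι 2F ⟪ a , b , c ⟫ = refl

π-∑ : ∀ j {X : Set} (f : X → ℤ[ω,ε]) xs → π j (∑ xs f) ≡ ∑ℤ.∑ xs (π j ∘ f)
π-∑ 0F f []       = refl
π-∑ 1F f []       = refl
π-∑ 2F f []       = refl
π-∑ j  f (x ∷ xs) = trans (π-+ j (f x) _) (cong (λ s → π j (f x) ℤ.+ s) (π-∑ j f xs))

0# 1# : ℤ[ω,ε]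
0# = ι ⟪ 0 , 0 , 0 ⟫
1# = ι ⟪ 1 , 0 , 0 ⟫

∑-monomial-⊛ : ∀ {m} (xs : Vec ℤ[ω,ε] m) L M → ∑ (L ⊛ M) (monomial xs) ≡
  ∑ L (monomial xs) ⊗ ∑ M (monomial xs)
∑-monomial-⊛ xs L M = begin
  ∑ (L ⊛ M) (monomial xs)
    ≡⟨ ∑-concatMap (monomial xs) (λ β → map (zipWith _+_ β) M) L ⟩
  (∑[ β ∈ L ] ∑ (map (zipWith _+_ β) M) (monomial xs))
    ≡⟨ ∑-cong (λ β → trans (∑-map (monomial xs) (zipWith _+_ β) M) (∑-cong (monomial-+ xs β) M)) L ⟩
  (∑[ β ∈ L ] ∑[ γ ∈ M ] (monomial xs β ⊗ monomial xs γ))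
    ≡⟨ ∑-*-∑ (monomial xs) (monomial xs) L M ⟨
  ∑ L (monomial xs) ⊗ ∑ M (monomial xs) ∎

Natural : ℤ[ω,ε] → Set
Natural r = ∃ λ t → r ≡ ι t

-- The coefficients of E(z) / (1 + xz) when E(z) = 1 + e₁z + e₂z² + e₃z³ + e₄z⁴ is divisible by 1 + xz.
cofactor₁ : ℕ[ε] → ℤ[ω,ε] → ℤ[ω,ε]
cofactor₁ e₁ x = ι e₁ ⊕ (⊝ x)

cofactor₂ : ℕ[ε] → ℕ[ε] → ℤ[ω,ε] → ℤ[ω,ε]
cofactor₂ e₁ e₂ x = ι e₂ ⊕ (⊝ (x ⊗ cofactor₁ e₁ x))

cofactor₃ : ℕ[ε] → ℕ[ε] → ℕ[ε] → ℤ[ω,ε] → ℤ[ω,ε]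
cofactor₃ e₁ e₂ e₃ x = ι e₃ ⊕ (⊝ (x ⊗ cofactor₂ e₁ e₂ x))

-- These are the consequences of ∏ (1 + xᵢz) = E(z) that the path computation uses. For explicit xᵢ
-- each of them holds by evaluation.
record Specialisation (e₁ e₂ e₃ e₄ : ℕ[ε]) : Set where
  field
    xs : Vec ℤ[ω,ε] 4
    -- The last coefficient equation of the division, making 1 + xᵢz a divisor of E(z).
    root : ∀ i → lookup xs i ⊗ cofactor₃ e₁ e₂ e₃ (lookup xs i) ≡ ι e₄
    squarefree₀ : ∑ (squarefree 4 0) (monomial xs) ≡ 1#
    squarefree₁ : ∑ (squarefree 4 1) (monomial xs) ≡ ι e₁
    squarefree₂ : ∑ (squarefree 4 2) (monomial xs) ≡ ι e₂
    squarefree₃ : ∑ (squarefree 4 3) (monomial xs) ≡ ι e₃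
    squarefree₄ : ∑ (squarefree 4 4) (monomial xs) ≡ ι e₄
    -- From here on, the four coefficients of ∑ xᵢ E(z)/(1 + xᵢz) = E′(z).
    ∑x  : ∑[ i ∈ allFin 4 ] lookup xs i ≡ ι e₁
    ∑xa : ∑[ i ∈ allFin 4 ] (lookup xs i ⊗ cofactor₁ e₁ (lookup xs i)) ≡ ι (e₂ +ᵗ e₂)
    ∑xb : ∑[ i ∈ allFin 4 ] (lookup xs i ⊗ cofactor₂ e₁ e₂ (lookup xs i)) ≡ ι (e₃ +ᵗ e₃ +ᵗ e₃)
    ∑xc : ∑[ i ∈ allFin 4 ] (lookup xs i ⊗ cofactor₃ e₁ e₂ e₃ (lookup xs i)) ≡
      ι (e₄ +ᵗ e₄ +ᵗ e₄ +ᵗ e₄)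

ζ ζ² : ℤ[ω]
ζ = 0ℤ + 1ℤ ω
ζ² = -1ℤ + -1ℤ ω

-- ∏ (1 + xᵢz) = 1 + 3εz + 3ε²z² + z³
deform₁ : Specialisation ⟪ 0 , 3 , 0 ⟫ ⟪ 0 , 0 , 3 ⟫ ⟪ 1 , 0 , 0 ⟫ ⟪ 0 , 0 , 0 ⟫
deform₁ = record
  -- Translating the cube roots of unity by ε gives (1 + εz)³ + z³, which is why an ε²z² term
  -- accompanies the perturbation in z.
  { xs = ⟨ 𝟏 , 𝟏 , 𝟎 ⟩ ∷ ⟨ ζ , 𝟏 , 𝟎 ⟩ ∷ ⟨ ζ² , 𝟏 , 𝟎 ⟩ ∷ ⟨ 𝟎 , 𝟎 , 𝟎 ⟩ ∷ []
  ; root = λ { 0F → refl ; 1F → refl ; 2F → refl ; 3F → refl }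
  ; squarefree₀ = refl ; squarefree₁ = refl ; squarefree₂ = refl ; squarefree₃ = refl
  ; squarefree₄ = refl
  ; ∑x = refl ; ∑xa = refl ; ∑xb = refl ; ∑xc = refl
  }

-- ∏ (1 + xᵢz) = 1 + 3εz² + z³
deform₂ : Specialisation ⟪ 0 , 0 , 0 ⟫ ⟪ 0 , 3 , 0 ⟫ ⟪ 1 , 0 , 0 ⟫ ⟪ 0 , 0 , 0 ⟫
deform₂ = record
  -- Cardano's formula for t³ + 3εt - 1: the roots are u - ε/u with u³ = 1, since ε³ = 0.
  { xs = ⟨ 𝟏 , Eisenstein.⊝ 𝟏 , 𝟎 ⟩ ∷ ⟨ ζ , Eisenstein.⊝ ζ² , 𝟎 ⟩ ∷ ⟨ ζ² , Eisenstein.⊝ ζ , 𝟎 ⟩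
    ∷ ⟨ 𝟎 , 𝟎 , 𝟎 ⟩ ∷ []
  ; root = λ { 0F → refl ; 1F → refl ; 2F → refl ; 3F → refl }
  ; squarefree₀ = refl ; squarefree₁ = refl ; squarefree₂ = refl ; squarefree₃ = refl
  ; squarefree₄ = refl
  ; ∑x = refl ; ∑xa = refl ; ∑xb = refl ; ∑xc = refl
  }

-2*_ : ℤ[ω] → ℤ[ω]
-2* x = Eisenstein.⊝ (x Eisenstein.⊕ x)

-- ∏ (1 + xᵢz) = 1 + z³ + 3εz⁴, from ζʲ − ε − 2ζ²ʲε² and 3ε
deform₄ : Specialisation ⟪ 0 , 0 , 0 ⟫ ⟪ 0 , 0 , 0 ⟫ ⟪ 1 , 0 , 0 ⟫ ⟪ 0 , 3 , 0 ⟫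
deform₄ = record
  -- Newton approximation to the roots of t⁴ - t + 3ε near ζʲ and near 0. The derivative 4t³ - 1
  -- equals 3 at ζʲ, so the factor 3 in e₄ keeps the corrections integral.
  { xs = ⟨ 𝟏 , Eisenstein.⊝ 𝟏 , -2* 𝟏 ⟩ ∷ ⟨ ζ , Eisenstein.⊝ 𝟏 , -2* ζ² ⟩
    ∷ ⟨ ζ² , Eisenstein.⊝ 𝟏 , -2* ζ ⟩ ∷ ⟨ 𝟎 , ⌜ 3 ⌝ , 𝟎 ⟩ ∷ []
  ; root = λ { 0F → refl ; 1F → refl ; 2F → refl ; 3F → refl }
  ; squarefree₀ = refl ; squarefree₁ = refl ; squarefree₂ = refl ; squarefree₃ = refl
  ; squarefree₄ = refl
  ; ∑x = refl ; ∑xa = refl ; ∑xb = refl ; ∑xc = refl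
  }

-- Values of paths and the resulting inequality

module PathSeries (e₁ e₂ e₃ e₄ : ℕ[ε]) where

  -- F (3 + n) is the coefficient of zⁿ in 1 / (1 − e₂z² − 2e₃z³ − 3e₄z⁴).
  F : ℕ → ℕ[ε]
  F 0 = ⟪ 0 , 0 , 0 ⟫
  F 1 = ⟪ 0 , 0 , 0 ⟫
  F 2 = ⟪ 0 , 0 , 0 ⟫
  F 3 = ⟪ 1 , 0 , 0 ⟫
  F (suc (suc (suc (suc n)))) =
    e₂ *ᵗ F (suc (suc n)) +ᵗ (e₃ +ᵗ e₃) *ᵗ F (suc n) +ᵗ (e₄ +ᵗ e₄ +ᵗ e₄) *ᵗ F n

  -- P₁₊ n is the value of the path on 1 + n vertices.
  P₁₊ : ℕ → ℕ[ε]
  P₁₊ n = e₁ *ᵗ F (3 + n) +ᵗ (e₂ +ᵗ e₂) *ᵗ F (2 + n) +ᵗ (e₃ +ᵗ e₃ +ᵗ e₃) *ᵗ F (1 + n)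
    +ᵗ (e₄ +ᵗ e₄ +ᵗ e₄ +ᵗ e₄) *ᵗ F n

  module _ (S : Specialisation e₁ e₂ e₃ e₄) where
    open Specialisation S

    f : ℕ → ℤ[ω,ε]
    f n = ι (F n)

    private
      a b c : ℤ[ω,ε] → ℤ[ω,ε]
      a = cofactor₁ e₁
      b = cofactor₂ e₁ e₂
      c = cofactor₃ e₁ e₂ e₃

    -- The coefficient of zⁿ in E(z) / ((1 + xz)(1 − e₂z² − 2e₃z³ − 3e₄z⁴)); the division by 1 + xz
    -- comes from leg (1 + n) i + xᵢ · leg n i being the value of the path on 1 + n vertices.
    legForm : ℕ → ℤ[ω,ε] → ℤ[ω,ε]
    legForm n x = f (3 + n) ⊕ a x ⊗ f (2 + n) ⊕ b x ⊗ f (1 + n) ⊕ c x ⊗ f n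

    ι-F : ∀ n → f (4 + n) ≡ ι e₂ ⊗ f (2 + n) ⊕ (ι e₃ ⊕ ι e₃) ⊗ f (1 + n) ⊕ (ι e₄ ⊕ ι e₄ ⊕ ι e₄) ⊗ f n
    ι-F n = begin
      f (4 + n)
        ≡⟨ ι-+ (e₂ *ᵗ F (2 + n) +ᵗ (e₃ +ᵗ e₃) *ᵗ F (1 + n)) _ ⟩
      ι (e₂ *ᵗ F (2 + n) +ᵗ (e₃ +ᵗ e₃) *ᵗ F (1 + n)) ⊕ ι ((e₄ +ᵗ e₄ +ᵗ e₄) *ᵗ F n)
        ≡⟨ cong₂ _⊕_ (trans (ι-+ (e₂ *ᵗ F (2 + n)) _) (cong₂ _⊕_ (ι-* e₂ _)
             (trans (ι-* (e₃ +ᵗ e₃) _) (cong (_⊗ f (1 + n)) (ι-+ e₃ e₃)))))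
             (trans (ι-* (e₄ +ᵗ e₄ +ᵗ e₄) _)
               (cong (_⊗ f n) (trans (ι-+ (e₄ +ᵗ e₄) e₄) (cong (_⊕ ι e₄) (ι-+ e₄ e₄))))) ⟩
      ι e₂ ⊗ f (2 + n) ⊕ (ι e₃ ⊕ ι e₃) ⊗ f (1 + n) ⊕ (ι e₄ ⊕ ι e₄ ⊕ ι e₄) ⊗ f n ∎

    ι-P₁₊ : ∀ n → ι (P₁₊ n) ≡
      ι e₁ ⊗ f (3 + n) ⊕ ι (e₂ +ᵗ e₂) ⊗ f (2 + n) ⊕ ι (e₃ +ᵗ e₃ +ᵗ e₃) ⊗ f (1 + n) ⊕
        ι (e₄ +ᵗ e₄ +ᵗ e₄ +ᵗ e₄) ⊗ f n
    ι-P₁₊ n = trans (ι-+ (p +ᵗ q +ᵗ r) s)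
      (cong₂ _⊕_ (trans (ι-+ (p +ᵗ q) r) (cong₂ _⊕_ (trans (ι-+ p q)
      (cong₂ _⊕_ (ι-* e₁ _) (ι-* (e₂ +ᵗ e₂) _))) (ι-* (e₃ +ᵗ e₃ +ᵗ e₃) _)))
        (ι-* (e₄ +ᵗ e₄ +ᵗ e₄ +ᵗ e₄) _))
      where
      p = e₁ *ᵗ F (3 + n)
      q = (e₂ +ᵗ e₂) *ᵗ F (2 + n)
      r = (e₃ +ᵗ e₃ +ᵗ e₃) *ᵗ F (1 + n)
      s = (e₄ +ᵗ e₄ +ᵗ e₄ +ᵗ e₄) *ᵗ F n

    -- Multiplication by 1 + xz cancels the division in `legForm` and leaves E/(E - zE′) = 1 +
    -- zE′/(E - zE′); `P₁₊` lists the coefficients of E′/(E - zE′).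
    legForm-step : ∀ n i → let x = lookup xs i in legForm (suc n) x ⊕ x ⊗ legForm n x ≡ ι (P₁₊ n)
    legForm-step n i = begin
      (f (4 + n) ⊕ a x ⊗ f (3 + n) ⊕ b x ⊗ f (2 + n) ⊕ c x ⊗ f (1 + n)) ⊕ x ⊗ legForm n x
        ≡⟨ cong (λ t → (t ⊕ a x ⊗ f (3 + n) ⊕ b x ⊗ f (2 + n) ⊕ c x ⊗ f (1 + n)) ⊕ x ⊗ legForm n x)
          (ι-F n) ⟩
      (ι e₂ ⊗ f (2 + n) ⊕ (ι e₃ ⊕ ι e₃) ⊗ f (1 + n) ⊕ (ι e₄ ⊕ ι e₄ ⊕ ι e₄) ⊗ f n
         ⊕ a x ⊗ f (3 + n) ⊕ b x ⊗ f (2 + n) ⊕ c x ⊗ f (1 + n)) ⊕ x ⊗ legForm n x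
        ≡⟨ identity (root i) ⟩
      ι e₁ ⊗ f (3 + n) ⊕ (ι e₂ ⊕ ι e₂) ⊗ f (2 + n) ⊕ (ι e₃ ⊕ ι e₃ ⊕ ι e₃) ⊗ f (1 + n) ⊕
        (ι e₄ ⊕ ι e₄ ⊕ ι e₄ ⊕ ι e₄) ⊗ f n
        ≡⟨ cong₂ _⊕_ (cong₂ _⊕_ (cong (λ t → ι e₁ ⊗ f (3 + n) ⊕ t ⊗ f (2 + n)) (ι-+ e₂ e₂))
              (cong (_⊗ f (1 + n)) (trans (ι-+ (e₃ +ᵗ e₃) e₃) (cong (_⊕ ι e₃) (ι-+ e₃ e₃)))))
              (cong (_⊗ f n) (trans (ι-+ (e₄ +ᵗ e₄ +ᵗ e₄) e₄)
                (cong (_⊕ ι e₄) (trans (ι-+ (e₄ +ᵗ e₄) e₄) (cong (_⊕ ι e₄) (ι-+ e₄ e₄)))))) ⟨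
      ι e₁ ⊗ f (3 + n) ⊕ ι (e₂ +ᵗ e₂) ⊗ f (2 + n) ⊕ ι (e₃ +ᵗ e₃ +ᵗ e₃) ⊗ f (1 + n) ⊕
        ι (e₄ +ᵗ e₄ +ᵗ e₄ +ᵗ e₄) ⊗ f n
        ≡⟨ ι-P₁₊ n ⟨
      ι (P₁₊ n) ∎
      where
      x = lookup xs i
      expand : ∀ x e₁ e₂ e₃ f₀ f₁ f₂ f₃ →
        let a = e₁ ⊕ (⊝ x)
            b = e₂ ⊕ (⊝ (x ⊗ a))
            c = e₃ ⊕ (⊝ (x ⊗ b))
            e₄ = x ⊗ c
        in (e₂ ⊗ f₂ ⊕ (e₃ ⊕ e₃) ⊗ f₁ ⊕ (e₄ ⊕ e₄ ⊕ e₄) ⊗ f₀ ⊕ a ⊗ f₃ ⊕ b ⊗ f₂ ⊕ c ⊗ f₁) ⊕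
          x ⊗ (f₃ ⊕ a ⊗ f₂ ⊕ b ⊗ f₁ ⊕ c ⊗ f₀)
          ≡ e₁ ⊗ f₃ ⊕ (e₂ ⊕ e₂) ⊗ f₂ ⊕ (e₃ ⊕ e₃ ⊕ e₃) ⊗ f₁ ⊕ (e₄ ⊕ e₄ ⊕ e₄ ⊕ e₄) ⊗ f₀
      expand = solve-∀ Truncated.ring
      identity : ∀ {e₄′} → x ⊗ c x ≡ e₄′ →
        (ι e₂ ⊗ f (2 + n) ⊕ (ι e₃ ⊕ ι e₃) ⊗ f (1 + n) ⊕ (e₄′ ⊕ e₄′ ⊕ e₄′) ⊗ f n
         ⊕ a x ⊗ f (3 + n) ⊕ b x ⊗ f (2 + n) ⊕ c x ⊗ f (1 + n)) ⊕ x ⊗ legForm n x ≡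
        ι e₁ ⊗ f (3 + n) ⊕ (ι e₂ ⊕ ι e₂) ⊗ f (2 + n) ⊕ (ι e₃ ⊕ ι e₃ ⊕ ι e₃) ⊗ f (1 + n) ⊕
          (e₄′ ⊕ e₄′ ⊕ e₄′ ⊕ e₄′) ⊗ f n
      identity refl = expand x (ι e₁) (ι e₂) (ι e₃) (f n) (f (1 + n)) (f (2 + n)) (f (3 + n))

    -- Weighting E/(1 + xᵢz) by xᵢ and summing gives E′, the numerator belonging to `P₁₊`.
    ∑-legForm : ∀ n → ∑[ i ∈ allFin 4 ] (lookup xs i ⊗ legForm n (lookup xs i)) ≡ ι (P₁₊ n)
    ∑-legForm n = begin
      (∑[ i ∈ allFin 4 ] (lookup xs i ⊗ legForm n (lookup xs i)))
        ≡⟨ ∑-cong (λ i → expand (lookup xs i) (a (lookup xs i)) (b (lookup xs i)) (c (lookup xs i))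
          (f n) (f (1 + n)) (f (2 + n)) (f (3 + n))) (allFin 4) ⟩
      (∑[ i ∈ allFin 4 ] (h₁ i ⊕ h₂ i ⊕ h₃ i ⊕ h₄ i))
        ≡⟨ trans (∑-+ (λ i → h₁ i ⊕ h₂ i ⊕ h₃ i) h₄ (allFin 4)) (cong (_⊕ ∑ (allFin 4) h₄)
             (trans (∑-+ (λ i → h₁ i ⊕ h₂ i) h₃ (allFin 4))
               (cong (_⊕ ∑ (allFin 4) h₃) (∑-+ h₁ h₂ (allFin 4))))) ⟩
      ∑ (allFin 4) h₁ ⊕ ∑ (allFin 4) h₂ ⊕ ∑ (allFin 4) h₃ ⊕ ∑ (allFin 4) h₄
        ≡⟨ cong₂ _⊕_ (cong₂ _⊕_ (cong₂ _⊕_ (out g₁ (3 + n) ∑x) (out g₂ (2 + n) ∑xa))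
          (out g₃ (1 + n) ∑xb)) (out g₄ n ∑xc) ⟩
      ι e₁ ⊗ f (3 + n) ⊕ ι (e₂ +ᵗ e₂) ⊗ f (2 + n) ⊕ ι (e₃ +ᵗ e₃ +ᵗ e₃) ⊗ f (1 + n) ⊕
        ι (e₄ +ᵗ e₄ +ᵗ e₄ +ᵗ e₄) ⊗ f n
        ≡⟨ ι-P₁₊ n ⟨
      ι (P₁₊ n) ∎
      where
      g₁ g₂ g₃ g₄ h₁ h₂ h₃ h₄ : Fin 4 → ℤ[ω,ε]
      h₁ i = g₁ i ⊗ f (3 + n)
      h₂ i = g₂ i ⊗ f (2 + n)
      h₃ i = g₃ i ⊗ f (1 + n)
      h₄ i = g₄ i ⊗ f n
      g₁ i = lookup xs i
      g₂ i = lookup xs i ⊗ a (lookup xs i)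
      g₃ i = lookup xs i ⊗ b (lookup xs i)
      g₄ i = lookup xs i ⊗ c (lookup xs i)
      expand : ∀ x a b c f₀ f₁ f₂ f₃ → x ⊗ (f₃ ⊕ a ⊗ f₂ ⊕ b ⊗ f₁ ⊕ c ⊗ f₀) ≡
        x ⊗ f₃ ⊕ (x ⊗ a) ⊗ f₂ ⊕ (x ⊗ b) ⊗ f₁ ⊕ (x ⊗ c) ⊗ f₀
      expand = solve-∀ Truncated.ring
      out : ∀ (g : Fin 4 → ℤ[ω,ε]) k {t} → ∑ (allFin 4) g ≡ ι t → ∑ (allFin 4) (λ i → g i ⊗ f k) ≡
        ι t ⊗ f k
      out g k eq = trans (∑-*ʳ (f k) g (allFin 4)) (cong (_⊗ f k) eq)

    -- A mutual induction: the legs of length n determine the path on 1 + n vertices, and that path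
    -- together with them determines the legs of length 1 + n.
    leg≡legForm : ∀ n i → leg xs n i ≡ legForm n (lookup xs i)
    pathSum≡P₁₊ : ∀ n → pathSum xs (suc n) ≡ ι (P₁₊ n)

    pathSum≡P₁₊ n = trans (∑-cong (λ i → cong (lookup xs i ⊗_) (leg≡legForm n i)) (allFin 4))
      (∑-legForm n)

    leg≡legForm zero    i = trans (leg-0 xs i) (initial (a x) (b x) (c x))
      where
      x = lookup xs i
      initial : ∀ a b c → 1# ≡ 1# ⊕ a ⊗ 0# ⊕ b ⊗ 0# ⊕ c ⊗ 0#
      initial = solve-∀ Truncated.ring
    leg≡legForm (suc n) i = +-cancelʳ (x ⊗ leg xs n i) _ _ (begin
      leg xs (suc n) i ⊕ x ⊗ leg xs n i       ≡⟨ leg-suc-+ xs n i ⟩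
      pathSum xs (suc n)                      ≡⟨ pathSum≡P₁₊ n ⟩
      ι (P₁₊ n)                           ≡⟨ legForm-step n i ⟨
      legForm (suc n) x ⊕ x ⊗ legForm n x
        ≡⟨ cong (λ l → legForm (suc n) x ⊕ x ⊗ l) (leg≡legForm n i) ⟨
      legForm (suc n) x ⊕ x ⊗ leg xs n i      ∎)
      where
      x = lookup xs i

    squarefree-natural : ∀ k → Natural (∑ (squarefree 4 k) (monomial xs))
    squarefree-natural 0 = _ , squarefree₀
    squarefree-natural 1 = _ , squarefree₁
    squarefree-natural 2 = _ , squarefree₂
    squarefree-natural 3 = _ , squarefree₃
    squarefree-natural 4 = _ , squarefree₄
    squarefree-natural (suc (suc (suc (suc (suc k))))) = ⟪ 0 , 0 , 0 ⟫ , refl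

    𝑒-monomials-natural : ∀ ks → Natural (∑ (𝑒-monomials 4 ks) (monomial xs))
    𝑒-monomials-natural []       = squarefree-natural 0
    𝑒-monomials-natural (k ∷ ks) with squarefree-natural k | 𝑒-monomials-natural ks
    ... | s , eq | t , eq′ = s *ᵗ t ,
      trans (∑-monomial-⊛ xs (squarefree 4 k) _) (trans (cong₂ _⊗_ eq eq′) (sym (ι-* s t)))

    0≤π-∑-proper : ∀ G → 𝑒-PositiveGraph G → ∀ j → 0ℤ ℤ.≤ π j (∑-proper xs G)
    0≤π-∑-proper G pos j = subst (0ℤ ℤ.≤_) coloured (𝑒-positive⇒0≤∑ G pos (π j ∘ monomial xs) λ ks →
      let t , eq = 𝑒-monomials-natural ks in
      subst (0ℤ ℤ.≤_) (sym (trans (sym (π-∑ j (monomial xs) (𝑒-monomials 4 ks)))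
        (trans (cong (π j) eq) (π-ι j t)))) (ℤ.+≤+ z≤n))
      where
      ws = words 4 (Graph.order G)
      coloured : ∑ℤ.∑ (coloured-monomials G 4) (π j ∘ monomial xs) ≡ π j (∑-proper xs G)
      coloured = trans (sym (π-∑ j (monomial xs) (coloured-monomials G 4))) (cong (π j) (begin
        ∑ (coloured-monomials G 4) (monomial xs)
          ≡⟨ ∑-map (monomial xs) content (filter (proper? G) ws) ⟩
        ∑ (filter (proper? G) ws) (monomial xs ∘ content)
          ≡⟨ ∑-cong (monomial-content≡weight xs) (filter (proper? G) ws) ⟩
        ∑ (filter (proper? G) ws) (weight xs)                 ≡⟨ ∑-filter (proper? G) (weight xs) ws ⟩
        ∑-proper xs G                                         ∎))

    spider-inequality : ∀ a b → 𝑒-PositiveGraph (spider (a ∷ b ∷ 2 ∷ [])) → ∀ j →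
      coefficient j (P₁₊ a *ᵗ P₁₊ (1 + b) +ᵗ P₁₊ b *ᵗ P₁₊ (1 + a)) ≤
      coefficient j (P₁₊ 1 *ᵗ P₁₊ (a + b) +ᵗ (P₁₊ 0 *ᵗ P₁₊ (1 + (a + b)) +ᵗ P₁₊ (2 + (a + b))))
    spider-inequality a b pos j = ℤ.drop‿+≤+ (subst₂ ℤ._≤_ (trans (ℤ.+-identityˡ _) (π-ι j L))
      (trans (sym (π-+ j X (ι L))) (trans (cong (π j) X+L≡N) (π-ι j N)))
      (ℤ.+-monoˡ-≤ (π j (ι L)) (0≤π-∑-proper (spider (a ∷ b ∷ 2 ∷ [])) pos j)))
      where
      X = ∑-proper xs (spider (a ∷ b ∷ 2 ∷ []))
      L = P₁₊ a *ᵗ P₁₊ (1 + b) +ᵗ P₁₊ b *ᵗ P₁₊ (1 + a)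
      N = P₁₊ 1 *ᵗ P₁₊ (a + b) +ᵗ (P₁₊ 0 *ᵗ P₁₊ (1 + (a + b)) +ᵗ P₁₊ (2 + (a + b)))
      ι-*-P : ∀ k l → ι (P₁₊ k *ᵗ P₁₊ l) ≡ pathSum xs (suc k) ⊗ pathSum xs (suc l)
      ι-*-P k l = trans (ι-* (P₁₊ k) (P₁₊ l)) (sym (cong₂ _⊗_ (pathSum≡P₁₊ k) (pathSum≡P₁₊ l)))
      X+L≡N : X ⊕ ι L ≡ ι N
      X+L≡N = begin
        X ⊕ ι L
          ≡⟨ cong (X ⊕_) (trans (ι-+ (P₁₊ a *ᵗ P₁₊ (1 + b)) _)
            (cong₂ _⊕_ (ι-*-P a (1 + b)) (ι-*-P b (1 + a)))) ⟩
        X ⊕ (pathSum xs (1 + a) ⊗ pathSum xs (2 + b) ⊕ pathSum xs (1 + b) ⊗ pathSum xs (2 + a))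
          ≡⟨ ∑-spider₂ xs a b ⟩
        pathSum xs 2 ⊗ pathSum xs (1 + (a + b)) ⊕
          (pathSum xs 1 ⊗ pathSum xs (2 + (a + b)) ⊕ pathSum xs (3 + (a + b)))
          ≡⟨ cong₂ _⊕_ (ι-*-P 1 (a + b))
            (trans (ι-+ (P₁₊ 0 *ᵗ P₁₊ (1 + (a + b))) _)
              (cong₂ _⊕_ (ι-*-P 0 (1 + (a + b))) (sym (pathSum≡P₁₊ (2 + (a + b)))))) ⟨
        ι (P₁₊ 1 *ᵗ P₁₊ (a + b)) ⊕ ι (P₁₊ 0 *ᵗ P₁₊ (1 + (a + b)) +ᵗ P₁₊ (2 + (a + b)))
          ≡⟨ ι-+ (P₁₊ 1 *ᵗ P₁₊ (a + b)) _ ⟨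
        ι N ∎

    -- Separating n and the path values from a and b lets closed forms be inserted at indices that
    -- agree only propositionally.
    spider-inequality-at : ∀ a b n → a + b ≡ n → 𝑒-PositiveGraph (spider (a ∷ b ∷ 2 ∷ [])) →
      ∀ {s₁ s₂ s₃ s₄ t₁ t₂ t₃} →
      P₁₊ a ≡ s₁ → P₁₊ (1 + b) ≡ s₂ → P₁₊ b ≡ s₃ → P₁₊ (1 + a) ≡ s₄ →
      P₁₊ n ≡ t₁ → P₁₊ (1 + n) ≡ t₂ → P₁₊ (2 + n) ≡ t₃ →
      ∀ j → coefficient j (s₁ *ᵗ s₂ +ᵗ s₃ *ᵗ s₄) ≤ coefficient j (P₁₊ 1 *ᵗ t₁ +ᵗ (P₁₊ 0 *ᵗ t₂ +ᵗ t₃))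
    spider-inequality-at a b _ refl pos refl refl refl refl refl refl refl = spider-inequality a b pos

-- Closed forms

extᵗ : ∀ {a b c a′ b′ c′} → a ≡ a′ → b ≡ b′ → c ≡ c′ → ⟪ a , b , c ⟫ ≡ ⟪ a′ , b′ , c′ ⟫
extᵗ refl refl refl = refl

-- The coefficient 3k · 2^(k-1) of z^(3k-1) in 3z²/(1 - 2z³)², that is, the effect of using the
-- perturbation of e₂ once. It sits at ε² for `deform₁` and at ε for `deform₂`.
D : ℕ → ℕ
D zero    = 0
D (suc k) = 3 * 2 ^ k + 2 * D k

2D : ∀ k → 2 * D k ≡ 3 * k * 2 ^ k
2D zero    = refl
2D (suc k) = begin
  2 * (3 * 2 ^ k + 2 * D k)            ≡⟨ cong (λ t → 2 * (3 * 2 ^ k + t)) (2D k) ⟩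
  2 * (3 * 2 ^ k + 3 * k * 2 ^ k)      ≡⟨ lemma k (2 ^ k) ⟩
  3 * suc k * 2 ^ suc k                ∎
  where
  lemma : ∀ k u → 2 * (3 * u + 3 * k * u) ≡ 3 * (1 + k) * (2 * u)
  lemma = ℕSolver.solve-∀

module Deform₁ where
  open PathSeries ⟪ 0 , 3 , 0 ⟫ ⟪ 0 , 0 , 3 ⟫ ⟪ 1 , 0 , 0 ⟫ ⟪ 0 , 0 , 0 ⟫ public

  F-closed : ∀ k →
    F (1 + k * 3) ≡ ⟪ 0 , 0 , 0 ⟫ ×
    F (2 + k * 3) ≡ ⟪ 0 , 0 , D k ⟫ ×
    F (3 + k * 3) ≡ ⟪ 2 ^ k , 0 , 0 ⟫
  F-closed zero    = refl , refl , refl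
  -- The value at k * 3 only meets the factor e₄ = 0; matching it as an arbitrary triple is enough
  -- for the product to reduce.
  F-closed (suc k) with F (k * 3) | F (1 + k * 3) | F (2 + k * 3) | F (3 + k * 3) | F-closed k
  ... | ⟪ x , y , z ⟫ | _ | _ | _ | refl , refl , refl =
    refl , extᵗ refl refl (lemma₁ (2 ^ k) (D k)) , extᵗ (ℕ.+-identityʳ (2 * 2 ^ k)) refl refl
    where
    lemma₁ : ∀ u d → 3 * u + (2 * d + 0 + 0) + 0 ≡ 3 * u + 2 * d
    lemma₁ = ℕSolver.solve-∀

  P₁₊-closed : ∀ k →
    P₁₊ (k * 3) ≡ ⟪ 0 , 3 * 2 ^ k , 0 ⟫ ×
    P₁₊ (1 + k * 3) ≡ ⟪ 0 , 0 , 6 * 2 ^ k + 3 * D k ⟫ ×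
    P₁₊ (2 + k * 3) ≡ ⟪ 3 * 2 ^ k , 0 , 0 ⟫
  P₁₊-closed k with F (k * 3) | F (1 + k * 3) | F (2 + k * 3) | F (3 + k * 3) | F-closed k
  ... | ⟪ x , y , z ⟫ | _ | _ | _ | refl , refl , refl =
    extᵗ refl (lemma₁ (2 ^ k)) refl , extᵗ refl refl (lemma₂ (2 ^ k) (D k)) , extᵗ
      (ℕ.+-identityʳ _) refl refl
    where
    lemma₁ : ∀ u → 3 * u + 0 + 0 + 0 ≡ 3 * u
    lemma₁ = ℕSolver.solve-∀
    lemma₂ : ∀ u d → 6 * u + (3 * d + 0 + 0) + 0 ≡ 6 * u + 3 * d
    lemma₂ = ℕSolver.solve-∀

module Deform₂ where
  open PathSeries ⟪ 0 , 0 , 0 ⟫ ⟪ 0 , 3 , 0 ⟫ ⟪ 1 , 0 , 0 ⟫ ⟪ 0 , 0 , 0 ⟫ public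

  -- The coefficient of z^(3k-2) in 9z⁴/(1 - 2z³)³, from using the perturbation twice.
  C : ℕ → ℕ
  C zero    = 0
  C (suc k) = 3 * D k + 2 * C k

  F-closed : ∀ k →
    F (1 + k * 3) ≡ ⟪ 0 , 0 , C k ⟫ ×
    F (2 + k * 3) ≡ ⟪ 0 , D k , 0 ⟫ ×
    F (3 + k * 3) ≡ ⟪ 2 ^ k , 0 , 0 ⟫
  F-closed zero    = refl , refl , refl
  F-closed (suc k) with F (k * 3) | F (1 + k * 3) | F (2 + k * 3) | F (3 + k * 3) | F-closed k
  ... | ⟪ x , y , z ⟫ | _ | _ | _ | refl , refl , refl =
    extᵗ refl refl (lemma₁ (D k) (C k)) , extᵗ refl (lemma₂ (2 ^ k) (D k)) refl , extᵗ
      (ℕ.+-identityʳ (2 * 2 ^ k)) refl refl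
    where
    lemma₁ : ∀ d c → 3 * d + 0 + (2 * c + 0 + 0) + 0 ≡ 3 * d + 2 * c
    lemma₁ = ℕSolver.solve-∀
    lemma₂ : ∀ u d → 3 * u + (2 * d + 0) + 0 ≡ 3 * u + 2 * d
    lemma₂ = ℕSolver.solve-∀

  P₁₊-closed : ∀ k →
    P₁₊ (k * 3) ≡ ⟪ 0 , 0 , 6 * D k + 3 * C k ⟫ ×
    P₁₊ (1 + k * 3) ≡ ⟪ 0 , 6 * 2 ^ k + 3 * D k , 0 ⟫ ×
    P₁₊ (2 + k * 3) ≡ ⟪ 3 * 2 ^ k , 0 , 0 ⟫
  P₁₊-closed k with F (k * 3) | F (1 + k * 3) | F (2 + k * 3) | F (3 + k * 3) | F-closed k
  ... | ⟪ x , y , z ⟫ | _ | _ | _ | refl , refl , refl =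
    extᵗ refl refl (lemma₁ (D k) (C k)) , extᵗ refl (lemma₂ (2 ^ k) (D k)) refl , extᵗ
      (ℕ.+-identityʳ _) refl refl
    where
    lemma₁ : ∀ d c → 6 * d + 0 + (3 * c + 0 + 0) + 0 ≡ 6 * d + 3 * c
    lemma₁ = ℕSolver.solve-∀
    lemma₂ : ∀ u d → 6 * u + (3 * d + 0) + 0 ≡ 6 * u + 3 * d
    lemma₂ = ℕSolver.solve-∀

module Deform₄ where
  open PathSeries ⟪ 0 , 0 , 0 ⟫ ⟪ 0 , 0 , 0 ⟫ ⟪ 1 , 0 , 0 ⟫ ⟪ 0 , 3 , 0 ⟫ public

  -- The coefficients of z^(3k+1) in 9z⁴/(1 - 2z³)² and of z^(3k+2) in 81z⁸/(1 - 2z³)³: the z⁴ term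
  -- is used once, respectively twice.
  G H : ℕ → ℕ
  G zero    = 0
  G (suc k) = 2 * G k + 9 * 2 ^ k
  H zero    = 0
  H (suc k) = 2 * H k + 9 * G k

  F-closed : ∀ k →
    F (3 + k * 3) ≡ ⟪ 2 ^ k , 0 , 0 ⟫ ×
    F (4 + k * 3) ≡ ⟪ 0 , G k , 0 ⟫ ×
    F (5 + k * 3) ≡ ⟪ 0 , 0 , H k ⟫ ×
    -- The value is H (k - 1), or 0 for k = 0. Divisibility by ε² suffices, because it is only ever
    -- multiplied by multiples of e₄ = 3ε.
    ∃ λ h → F (2 + k * 3) ≡ ⟪ 0 , 0 , h ⟫
  F-closed zero    = refl , refl , refl , 0 , refl
  F-closed (suc k) with F (2 + k * 3) | F (3 + k * 3) | F (4 + k * 3) | F (5 + k * 3) | F-closed k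
  ... | _ | _ | _ | _ | refl , refl , refl , h , refl =
    extᵗ (ℕ.+-identityʳ (2 * 2 ^ k)) refl refl , extᵗ refl (lemma₁ (G k) (2 ^ k)) refl , extᵗ refl
      refl (lemma₂ (H k) (G k)) , H k , refl
    where
    lemma₁ : ∀ g u → 2 * g + 0 + 9 * u ≡ 2 * g + 9 * u
    lemma₁ = ℕSolver.solve-∀
    lemma₂ : ∀ h g → 2 * h + 0 + 0 + (9 * g + 0) ≡ 2 * h + 9 * g
    lemma₂ = ℕSolver.solve-∀

  P₁₊-closed : ∀ k →
    P₁₊ (2 + k * 3) ≡ ⟪ 3 * 2 ^ k , 0 , 0 ⟫ ×
    P₁₊ (3 + k * 3) ≡ ⟪ 0 , 3 * G k + 12 * 2 ^ k , 0 ⟫ ×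
    P₁₊ (4 + k * 3) ≡ ⟪ 0 , 0 , 3 * H k + 12 * G k ⟫
  P₁₊-closed k with F (2 + k * 3) | F (3 + k * 3) | F (4 + k * 3) | F (5 + k * 3) | F-closed k
  ... | _ | _ | _ | _ | refl , refl , refl , h , refl =
    extᵗ (ℕ.+-identityʳ _) refl refl , extᵗ refl (lemma₁ (G k) (2 ^ k)) refl , extᵗ refl refl
      (lemma₂ (H k) (G k))
    where
    lemma₁ : ∀ g u → 3 * g + 0 + 12 * u ≡ 3 * g + 12 * u
    lemma₁ = ℕSolver.solve-∀
    lemma₂ : ∀ h g → 3 * h + 0 + 0 + (12 * g + 0) ≡ 3 * h + 12 * g
    lemma₂ = ℕSolver.solve-∀

  2G : ∀ k → 2 * G k ≡ 9 * k * 2 ^ k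
  2G zero    = refl
  2G (suc k) = begin
    2 * (2 * G k + 9 * 2 ^ k)             ≡⟨ lemma₁ (G k) (2 ^ k) ⟩
    2 * (2 * G k) + 18 * 2 ^ k            ≡⟨ cong (λ t → 2 * t + 18 * 2 ^ k) (2G k) ⟩
    2 * (9 * k * 2 ^ k) + 18 * 2 ^ k      ≡⟨ lemma₂ k (2 ^ k) ⟩
    9 * suc k * 2 ^ suc k                 ∎
    where
    lemma₁ : ∀ g u → 2 * (2 * g + 9 * u) ≡ 2 * (2 * g) + 18 * u
    lemma₁ = ℕSolver.solve-∀
    lemma₂ : ∀ k u → 2 * (9 * k * u) + 18 * u ≡ 9 * (1 + k) * (2 * u)
    lemma₂ = ℕSolver.solve-∀

  -- H k is 81 · (k choose 2) · 2^(k-2), cleared of its denominator and with the negative term moved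
  -- to the left.
  8H : ∀ k → 8 * H k + 81 * k * 2 ^ k ≡ 81 * (k * k) * 2 ^ k
  8H zero    = refl
  8H (suc k) = begin
    8 * (2 * H k + 9 * G k) + 81 * suc k * 2 ^ suc k
      ≡⟨ lemma₁ (H k) (G k) k (2 ^ k) ⟩
    2 * (8 * H k + 81 * k * 2 ^ k) + 36 * (2 * G k) + 162 * 2 ^ k
      ≡⟨ cong₂ (λ s t → 2 * s + 36 * t + 162 * 2 ^ k) (8H k) (2G k) ⟩
    2 * (81 * (k * k) * 2 ^ k) + 36 * (9 * k * 2 ^ k) + 162 * 2 ^ k
      ≡⟨ lemma₂ k (2 ^ k) ⟩
    81 * (suc k * suc k) * 2 ^ suc k ∎
    where
    lemma₁ : ∀ h g k u → 8 * (2 * h + 9 * g) + 81 * (1 + k) * (2 * u) ≡ 2 * (8 * h + 81 * k * u) +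
      36 * (2 * g) + 162 * u
    lemma₁ = ℕSolver.solve-∀
    lemma₂ : ∀ k u → 2 * (81 * (k * k) * u) + 36 * (9 * k * u) + 162 * u ≡
      81 * ((1 + k) * (1 + k)) * (2 * u)
    lemma₂ = ℕSolver.solve-∀

-- The excluded residues

-- The surplus is split as w + V so that positivity has to be known only of V, a power of two in
-- every application.
exceeds : ∀ {x y V} w → 0 < V → x ≡ y + w + V → ¬ x ≤ y
exceeds {y = y} {V} w 0<V refl x≤y = ℕ.<⇒≱
  (ℕ.<-≤-trans (ℕ.m<m+n y 0<V) (ℕ.+-monoˡ-≤ V (ℕ.m≤m+n y w))) x≤y

2^+ : ∀ p s → 2 ^ (p + s) ≡ 2 ^ p * 2 ^ s
2^+ = ℕ.^-distribˡ-+-* 2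

0<2^ : ∀ n → 0 < 2 ^ n
0<2^ = ℕ.m^n>0 2

open Deform₁ using () renaming (P₁₊-closed to P-closed₁)

-- Modulo ε only paths whose order is divisible by 3 survive. The spider splits into two of these,
-- contributing 9 · 2^(p+s) on the left, against 6 · 2^(p+s) from the single path P (a+b+3) on the
-- right.
¬positive-12 : ∀ p s → ¬ 𝑒-PositiveGraph (spider (1 + p * 3 ∷ 2 + s * 3 ∷ 2 ∷ []))
¬positive-12 p s pos =
  let _ , p₁ , p₂ = P-closed₁ p
      _ , _ , s₂ = P-closed₁ s
      n₀ , n₁ , n₂ = P-closed₁ (suc (p + s))
  in exceeds (2 * 2 ^ (p + s)) (0<2^ (p + s)) (identity (2 ^ p) (2 ^ s) (2^+ p s))
    (Deform₁.spider-inequality-at deform₁ (1 + p * 3) (2 + s * 3) (suc (p + s) * 3) (index p s) pos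
      p₁ (proj₁ (P-closed₁ (suc s))) s₂ p₂ n₀ n₁ n₂ 0F)
  where
  index : ∀ p s → 1 + p * 3 + (2 + s * 3) ≡ (1 + (p + s)) * 3
  index = ℕSolver.solve-∀
  -- Replacing the powers of two by variables turns the comparison into a polynomial identity.
  identity : ∀ u v {V} → V ≡ u * v → 3 * v * (3 * u) ≡ 3 * (2 * V) + 2 * V + V
  identity u v refl = go u v
    where
    go : ∀ u v → 3 * v * (3 * u) ≡ 3 * (2 * (u * v)) + 2 * (u * v) + u * v
    go = ℕSolver.solve-∀

¬positive-21 : ∀ p s → ¬ 𝑒-PositiveGraph (spider (2 + p * 3 ∷ 1 + s * 3 ∷ 2 ∷ []))
¬positive-21 p s pos =
  let _ , p₁ , p₂ = P-closed₁ p
      s₀ , s₁ , s₂ = P-closed₁ s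
      n₀ , n₁ , n₂ = P-closed₁ (suc (p + s))
  in exceeds (2 * 2 ^ (p + s)) (0<2^ (p + s)) (identity (2 ^ p) (2 ^ s) (2^+ p s))
    (Deform₁.spider-inequality-at deform₁ (2 + p * 3) (1 + s * 3) (suc (p + s) * 3) (index p s) pos
      p₂ s₂ s₁ (proj₁ (P-closed₁ (suc p))) n₀ n₁ n₂ 0F)
  where
  index : ∀ p s → 2 + p * 3 + (1 + s * 3) ≡ (1 + (p + s)) * 3
  index = ℕSolver.solve-∀
  identity : ∀ u v {V} → V ≡ u * v → 3 * u * (3 * v) + 0 ≡ 3 * (2 * V) + 2 * V + V
  identity u v refl = go u v
    where
    go : ∀ u v → 3 * u * (3 * v) + 0 ≡ 3 * (2 * (u * v)) + 2 * (u * v) + u * v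
    go = ℕSolver.solve-∀

-- At order ε each product on the left gives 18 · 2^(p+s), while on the right P 1 P (a+b+2) gives 18
-- · 2^(p+s) and P (a+b+3) gives 12 · 2^(p+s).
¬positive-22 : ∀ p s → ¬ 𝑒-PositiveGraph (spider (2 + p * 3 ∷ 2 + s * 3 ∷ 2 ∷ []))
¬positive-22 p s pos =
  let _ , _ , p₂ = P-closed₁ p
      _ , _ , s₂ = P-closed₁ s
      _ , n₁ , n₂ = P-closed₁ (suc (p + s))
  in exceeds (5 * 2 ^ (p + s)) (0<2^ (p + s)) (identity (2 ^ p) (2 ^ s) (2^+ p s))
    (Deform₁.spider-inequality-at deform₁ (2 + p * 3) (2 + s * 3) (1 + suc (p + s) * 3)
      (index p s) pos
      p₂ (proj₁ (P-closed₁ (suc s))) s₂ (proj₁ (P-closed₁ (suc p))) n₁ n₂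
        (proj₁ (P-closed₁ (2 + (p + s)))) 1F)
  where
  index : ∀ p s → 2 + p * 3 + (2 + s * 3) ≡ 1 + (1 + (p + s)) * 3
  index = ℕSolver.solve-∀
  identity : ∀ u v {V} → V ≡ u * v → 3 * u * (3 * (2 * v)) + 0 + (3 * v * (3 * (2 * u)) + 0) ≡
    3 * (3 * (2 * V)) + 3 * (2 * (2 * V)) + 5 * V + V
  identity u v refl = go u v
    where
    go : ∀ u v → 3 * u * (3 * (2 * v)) + 0 + (3 * v * (3 * (2 * u)) + 0) ≡
      3 * (3 * (2 * (u * v))) + 3 * (2 * (2 * (u * v))) + 5 * (u * v) + u * v
    go = ℕSolver.solve-∀

-- Twice the surplus at order ε is (9(p + q) - 6) · 2^(p+q), where b = 1 + 3q. It would be negative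
-- for a = b = 1; taking q to be a successor is where 2 ≤ b enters.
¬positive-11 : ∀ p s → ¬ 𝑒-PositiveGraph (spider (1 + p * 3 ∷ 1 + suc s * 3 ∷ 2 ∷ []))
¬positive-11 p s′ pos =
  let _ , p₁ , p₂ = Deform₂.P₁₊-closed p
      _ , s₁ , s₂ = Deform₂.P₁₊-closed (suc s′)
      _ , n₁ , n₂ = Deform₂.P₁₊-closed (p + suc s′)
      n₃ , n₄ , _ = Deform₂.P₁₊-closed (suc (p + suc s′))
  in exceeds (9 * (p + s′) * V + 2 * V) (0<2^ (p + s))
    (identity p s′ {dₚ = D p} {D s} {D (p + s)} (2^+ p s) (2D p) (2D s) (2D (p + s)))
    -- Doubled, because the closed form of `D` has denominator 2.
    (ℕ.*-monoʳ-≤ 2 (Deform₂.spider-inequality-at deform₂ (1 + p * 3) (1 + s * 3) (2 + (p + s) * 3)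
      (index p s) pos
      p₁ s₂ s₁ p₂ n₂ n₃ n₄ 1F))
  where
  s = suc s′
  V = 2 ^ (p + s)
  index : ∀ p s → 1 + p * 3 + (1 + s * 3) ≡ 2 + (p + s) * 3
  index = ℕSolver.solve-∀
  identity : ∀ p s {u v V dₚ dₛ d} → V ≡ u * v → 2 * dₚ ≡ 3 * p * u → 2 * dₛ ≡
    3 * (1 + s) * v → 2 * d ≡ 3 * (p + (1 + s)) * V →
    2 * ((6 * u + 3 * dₚ) * (3 * v) + (6 * v + 3 * dₛ) * (3 * u)) ≡
    2 * (6 * (3 * V) + (6 * (2 * V) + 3 * (3 * V + 2 * d))) + (9 * (p + s) * V + 2 * V) + V
  identity p s {u} {v} {_} {dₚ} {dₛ} {d} refl eqₚ eqₛ eq = begin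
    2 * ((6 * u + 3 * dₚ) * (3 * v) + (6 * v + 3 * dₛ) * (3 * u))
      ≡⟨ expand u v dₚ dₛ ⟩
    72 * u * v + 9 * (2 * dₚ) * v + 9 * (2 * dₛ) * u
      ≡⟨ cong₂ (λ t t′ → 72 * u * v + 9 * t * v + 9 * t′ * u) eqₚ eqₛ ⟩
    72 * u * v + 9 * (3 * p * u) * v + 9 * (3 * (1 + s) * v) * u
      ≡⟨ collect p s u v ⟩
    2 * (6 * (3 * (u * v)) + (6 * (2 * (u * v)) + 3 * (3 * (u * v) + 3 * (p + (1 + s)) * (u * v))))
      + (9 * (p + s) * (u * v) + 2 * (u * v)) + u * v
      ≡⟨ cong (λ t → 2 * (6 * (3 * (u * v)) + (6 * (2 * (u * v)) + 3 * (3 * (u * v) + t))) +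
        (9 * (p + s) * (u * v) + 2 * (u * v)) + u * v) eq ⟨
    2 * (6 * (3 * (u * v)) + (6 * (2 * (u * v)) + 3 * (3 * (u * v) + 2 * d))) +
      (9 * (p + s) * (u * v) + 2 * (u * v)) + u * v ∎
    where
    expand : ∀ u v dₚ dₛ → 2 * ((6 * u + 3 * dₚ) * (3 * v) + (6 * v + 3 * dₛ) * (3 * u)) ≡
      72 * u * v + 9 * (2 * dₚ) * v + 9 * (2 * dₛ) * u
    expand = ℕSolver.solve-∀
    collect : ∀ p s u v → 72 * u * v + 9 * (3 * p * u) * v + 9 * (3 * (1 + s) * v) * u ≡
      2 * (6 * (3 * (u * v)) +
        (6 * (2 * (u * v)) + 3 * (3 * (u * v) + 3 * (p + (1 + s)) * (u * v)))) +
          (9 * (p + s) * (u * v) + 2 * (u * v)) + u * v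
    collect = ℕSolver.solve-∀

-- At order ε² the surplus is a quadratic polynomial times V. In p and s it has a negative s² term;
-- substituting p = s + d, which encodes a ≥ b, makes all its coefficients positive.
¬positive-02-+ : ∀ s d → ¬ 𝑒-PositiveGraph (spider (suc (s + d) * 3 ∷ 2 + s * 3 ∷ 2 ∷ []))
¬positive-02-+ s d pos =
  let p₂ , p₃ , p₄ = Deform₄.P₁₊-closed (s + d)
      s₂ , s₃ , s₄ = Deform₄.P₁₊-closed s
      n₂ , n₃ , n₄ = Deform₄.P₁₊-closed (suc (s + d + s))
  in exceeds (9 * (27 * s * s + 108 * s * d + 27 * d * d + 51 * s + 57 * d + 31) * V + 8 * V)
    (0<2^ (s + d + s))
    (identity s d {gₚ = Deform₄.G (s + d)} {Deform₄.G s} {Deform₄.G (s + d + s)}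
      {Deform₄.H (s + d)} {Deform₄.H (s + d + s)}
      (2^+ (s + d) s) (Deform₄.2G (s + d)) (Deform₄.2G s) (Deform₄.2G (s + d + s))
        (Deform₄.8H (s + d)) (Deform₄.8H (s + d + s)))
    -- The factor 8 clears the denominators of `H`. The two added terms are 9 and 6 times the linear
    -- terms that `8H` places beside 8H (s + d), multiplied by `2 ^ s`, and beside 8H (s + d + s).
    (ℕ.+-monoˡ-≤ (729 * (s + d) * V + 486 * (s + d + s) * V) (ℕ.*-monoʳ-≤ 8
      (Deform₄.spider-inequality-at deform₄ (suc (s + d) * 3) (2 + s * 3) (2 + suc (s + d + s) * 3)
        (index (s + d) s) pos
      p₃ s₃ s₂ p₄ n₂ n₃ n₄ 2F)))
  where
  V = 2 ^ (s + d + s)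
  index : ∀ p s → (1 + p) * 3 + (2 + s * 3) ≡ 2 + (1 + (p + s)) * 3
  index = ℕSolver.solve-∀
  identity : ∀ s d {u v V gₚ gₛ g hₚ h} → (let p = s + d ; q = p + s) → V ≡ u * v →
    2 * gₚ ≡ 9 * p * u → 2 * gₛ ≡ 9 * s * v → 2 * g ≡ 9 * q * V →
    8 * hₚ + 81 * p * u ≡ 81 * (p * p) * u → 8 * h + 81 * q * V ≡ 81 * (q * q) * V →
    8 * ((3 * gₚ + 12 * u) * (3 * gₛ + 12 * v) + 0 + (3 * v * (3 * hₚ + 12 * gₚ) + 0 + 0)) +
      (729 * p * V + 486 * q * V) ≡
    8 * (3 * (2 * h + 9 * g) + 12 * (2 * g + 9 * V)) + (729 * p * V + 486 * q * V)
      + (9 * (27 * s * s + 108 * s * d + 27 * d * d + 51 * s + 57 * d + 31) * V + 8 * V) + V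
  identity s d {u} {v} {_} {gₚ} {gₛ} {g} {hₚ} {h} refl eqₚ eqₛ eq eqₕₚ eqₕ = begin
    8 * ((3 * gₚ + 12 * u) * (3 * gₛ + 12 * v) + 0 + (3 * v * (3 * hₚ + 12 * gₚ) + 0 + 0)) +
      (729 * p * (u * v) + 486 * q * (u * v))
      ≡⟨ expand p q u v gₚ gₛ hₚ ⟩
    2 * (3 * (2 * gₚ) + 24 * u) * (3 * (2 * gₛ) + 24 * v) +
      3 * v * (3 * (8 * hₚ + 81 * p * u) + 48 * (2 * gₚ)) + 486 * q * (u * v)
      ≡⟨ cong₂ (λ x y → 2 * (3 * x + 24 * u) * (3 * y + 24 * v) +
        3 * v * (3 * (8 * hₚ + 81 * p * u) + 48 * x) + 486 * q * (u * v)) eqₚ eqₛ ⟩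
    2 * (3 * (9 * p * u) + 24 * u) * (3 * (9 * s * v) + 24 * v) +
      3 * v * (3 * (8 * hₚ + 81 * p * u) + 48 * (9 * p * u)) + 486 * q * (u * v)
      ≡⟨ cong (λ x → 2 * (3 * (9 * p * u) + 24 * u) * (3 * (9 * s * v) + 24 * v) +
        3 * v * (3 * x + 48 * (9 * p * u)) + 486 * q * (u * v)) eqₕₚ ⟩
    2 * (3 * (9 * p * u) + 24 * u) * (3 * (9 * s * v) + 24 * v) +
      3 * v * (3 * (81 * (p * p) * u) + 48 * (9 * p * u)) + 486 * q * (u * v)
      ≡⟨ compare s d u v ⟩
    6 * (81 * (q * q) * (u * v)) + 204 * (9 * q * (u * v)) + 864 * (u * v) + 729 * p * (u * v) +
      W + u * v
      ≡⟨ cong₂ (λ x y → 6 * x + 204 * y + 864 * (u * v) + 729 * p * (u * v) + W + u * v) eqₕ eq ⟨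
    6 * (8 * h + 81 * q * (u * v)) + 204 * (2 * g) + 864 * (u * v) + 729 * p * (u * v) + W + u * v
      ≡⟨ collect p q (u * v) g h W ⟩
    8 * (3 * (2 * h + 9 * g) + 12 * (2 * g + 9 * (u * v))) +
      (729 * p * (u * v) + 486 * q * (u * v)) + W + u * v ∎
    where
    p = s + d
    q = p + s
    W = 9 * (27 * s * s + 108 * s * d + 27 * d * d + 51 * s + 57 * d + 31) * (u * v) + 8 * (u * v)
    expand : ∀ p q u v gₚ gₛ hₚ →
      8 * ((3 * gₚ + 12 * u) * (3 * gₛ + 12 * v) + 0 + (3 * v * (3 * hₚ + 12 * gₚ) + 0 + 0)) +
        (729 * p * (u * v) + 486 * q * (u * v)) ≡
      2 * (3 * (2 * gₚ) + 24 * u) * (3 * (2 * gₛ) + 24 * v) +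
        3 * v * (3 * (8 * hₚ + 81 * p * u) + 48 * (2 * gₚ)) + 486 * q * (u * v)
    expand = ℕSolver.solve-∀
    compare : ∀ s d u v →
      2 * (3 * (9 * (s + d) * u) + 24 * u) * (3 * (9 * s * v) + 24 * v) +
        3 * v * (3 * (81 * ((s + d) * (s + d)) * u) + 48 * (9 * (s + d) * u)) +
          486 * (s + d + s) * (u * v) ≡
      6 * (81 * ((s + d + s) * (s + d + s)) * (u * v)) + 204 * (9 * (s + d + s) * (u * v)) +
        864 * (u * v) + 729 * (s + d) * (u * v)
        + (9 * (27 * s * s + 108 * s * d + 27 * d * d + 51 * s + 57 * d + 31) * (u * v) +
          8 * (u * v)) + u * v
    compare = ℕSolver.solve-∀
    collect : ∀ p q V g h W → 6 * (8 * h + 81 * q * V) + 204 * (2 * g) + 864 * V + 729 * p * V +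
      W + V ≡
      8 * (3 * (2 * h + 9 * g) + 12 * (2 * g + 9 * V)) + (729 * p * V + 486 * q * V) + W + V
    collect = ℕSolver.solve-∀

¬positive-02 : ∀ {p s} → s ≤ p → ¬ 𝑒-PositiveGraph (spider (suc p * 3 ∷ 2 + s * 3 ∷ 2 ∷ []))
¬positive-02 {s = s} s≤p = go (ℕ.m≤n⇒∃[o]m+o≡n s≤p)
  where
  go : ∀ {p} → (∃ λ d → s + d ≡ p) → ¬ 𝑒-PositiveGraph (spider (suc p * 3 ∷ 2 + s * 3 ∷ 2 ∷ []))
  go (d , refl) = ¬positive-02-+ s d

-- Case distinction modulo 3

data Residue (n : ℕ) : Set where
  residue₀ : ∀ k → n % 3 ≡ 0 → n ≡ k * 3 → Residue n
  residue₁ : ∀ k → n % 3 ≡ 1 → n ≡ 1 + k * 3 → Residue n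
  residue₂ : ∀ k → n % 3 ≡ 2 → n ≡ 2 + k * 3 → Residue n

residue : ∀ n → Residue n
residue n with n % 3 in eq | m%n<n n 3 | m≡m%n+[m/n]*n n 3
... | 0 | _ | n≡ = residue₀ (n / 3) eq n≡
... | 1 | _ | n≡ = residue₁ (n / 3) eq n≡
... | 2 | _ | n≡ = residue₂ (n / 3) eq n≡
... | suc (suc (suc _)) | s≤s (s≤s (s≤s ())) | _

classify : ∀ {a b} → Residue a → Residue b → b ≤ a → 2 ≤ b →
  𝑒-PositiveGraph (spider (a ∷ b ∷ 2 ∷ [])) →
  (a % 3 ≡ 0 × b % 3 ≡ 1) ⊎ b % 3 ≡ 0
classify _                         (residue₀ s s% _)    _ _ _ = inj₂ s%
classify (residue₀ p p% _)         (residue₁ s s% _)    _ _ _ = inj₁ (p% , s%)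
-- Here b = 1, contradicting 2 ≤ b.
classify (residue₁ p _ refl)       (residue₁ zero _ refl) _ (s≤s ()) _
classify (residue₁ p _ refl)       (residue₁ (suc s) _ refl) _ _ pos = contradiction pos
  (¬positive-11 p s)
classify (residue₂ p _ refl)       (residue₁ s _ refl)  _ _ pos = contradiction pos (¬positive-21 p s)
classify (residue₀ zero _ refl)    (residue₂ s _ refl)  () _ _
classify (residue₀ (suc p) _ refl) (residue₂ s _ refl)  b≤a _ pos = contradiction pos
  (¬positive-02 s≤p)
  where
  s≤p : s ≤ p
  -- If p < s, then a = 3 + 3p is at most 3s, hence less than b = 2 + 3s.
  s≤p = ℕ.≮⇒≥ λ p<s → ℕ.<⇒≱ (ℕ.m≤n⇒m≤1+n (s≤s (ℕ.*-monoˡ-≤ 3 p<s))) b≤a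
classify (residue₁ p _ refl)       (residue₂ s _ refl)  _ _ pos = contradiction pos (¬positive-12 p s)
classify (residue₂ p _ refl)       (residue₂ s _ refl)  _ _ pos = contradiction pos (¬positive-22 p s)

theorem4p1 : (a b : ℕ) → b ≤ a → 2 ≤ b →
    𝑒-PositiveGraph (spider (a ∷ b ∷ 2 ∷ [])) →
    (a % 3 ≡ 0 × b % 3 ≡ 1) ⊎ b % 3 ≡ 0
theorem4p1 a b = classify (residue a) (residue b)
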